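{- For every $S\in\mathsf{SVW}_{n,m}$ one has $P_{\mathsf{hecke}}(S)=\mathsf{tab}(\mathsf{rect}(S))$.
   Context: $[n]=\{1,\dots,n\}$, $\mathbf{e}_k$ standard basis of $\mathbb{Z}^n$. For a subset $T\subseteq[n]$ (possibly empty) let $\mathrm{wt}(T)=\sum_{j\in T}\mathbf{e}_j$ and for $i\in[n-1]$: $e_i(T)=T\cup\{i\}$ if $T\cap\{i,i+1\}=\{i+1\}$, $T\setminus\{i+1\}$ if $T\cap\{i,i+1\}=\{i,i+1\}$, else $0$; $f_i(T)=T\cup\{i+1\}$ if $T\cap\{i,i+1\}=\{i\}$, $T\setminus\{i\}$ if $T\cap\{i,i+1\}=\{i,i+1\}$, else $0$. Let $\varepsilon_i(b)=\sup\{k:e_i^k(b)\ne0\}$ and $\varphi_i(b)=\sup\{k:f_i^k(b)\ne 0\}$. Tensor products: weights add, $e_i(b\otimes c)=b\otimes e_i(c)$ if $\varepsilon_i(b)\le\varphi_i(c)$ else $e_i(b)\otimes c$, $f_i(b\otimes c)=b\otimes f_i(c)$ if $\varepsilon_i(b)<\varphi_i(c)$ else $f_i(b)\otimes c$, with $b\otimes0=0\otimes c=0$. $\mathsf{SVW}_{n,m}$ is the set of $m$-tuples $S=(S_1,\dots,S_m)$ of subsets of $[n]$, a $\sqrt{\mathfrak{gl}_n}$-crystal via $S\leftrightarrow S_1\otimes\cdots\otimes S_m$. Define $E_i(S)=e_i^{\varepsilon_i(S)}(S)$ and $\mathsf{rect}=(E_1E_2\cdots E_{n-1})\cdots(E_1E_2)(E_1)$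 (composition, rightmost first). $\mathsf{tab}(S)$ is the left-justified tableau (matrix coordinates) whose row $i$ lists the numbers $m+1-j$, over $j\in[m]$ with $i\in S_j$, in increasing order. Hecke insertion of a positive integer $x$ into an increasing tableau (Young-diagram shape, strictly increasing rows and columns): process columns from the first; to insert $x$ into a column, let $y$ be the smallest entry of the column with $x<y$; if no such $y$ exists, append $x$ at the bottom of the column if the result is an increasing tableau, otherwise leave it unchanged, and stop; if $y$ exists, replace $y$ by $x$ if the result is increasing, otherwise leave it unchanged, and in either case insert the bumped $y$ into the next column in the same way. For $i\in[n]$, if $j_1<\dots<j_k$ are the indices $j$ with $i\in S_j$, let $A_i$ be the word $(m+1-j_1)(m+1-j_2)\cdots(m+1-j_k)$, and let $A(S)=A_1A_2\cdots A_n$ (concatenation). $P_{\mathsf{hecke}}(S)$ is the tableau obtained by Hecke inserting the letters of $A(S)$ one at a time, left to right, starting from the empty tableau. -}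

module Defs where

open import Data.Bool using (Bool; true; false; if_then_else_; _∧_; not)
open import Data.Nat using (ℕ; zero; suc; _+_; _*_; _∸_; _<ᵇ_; _≤ᵇ_)
open import Data.List using (List; []; _∷_; _++_; [_]; reverse; length; upTo; map; concatMap; foldl; zip)
open import Data.Vec using (Vec; []; _∷_; toList)
open import Data.Maybe using (Maybe; just; nothing; _>>=_)
import Data.Maybe as Maybe
open import Data.Product using (_×_; _,_)
open import Data.Fin.Subset using (Subset)

-- Subsets of [n] are  Subset n = Vec Bool n ; position k (0-based) of the
-- vector records membership of the element k+1.  Elements are ℕ, 1-based.

memV : ∀ {n} → Subset n → ℕ → Bool
memV [] _ = false
memV (b ∷ _) zero = b
memV (_ ∷ v) (suc k) = memV v k

setV : ∀ {n} → Subset n → ℕ → Bool → Subset n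
setV [] _ _ = []
setV (_ ∷ v) zero b = b ∷ v
setV (c ∷ v) (suc k) b = c ∷ setV v k b

mem : ∀ {n} → Subset n → ℕ → Bool
mem T zero = false
mem T (suc k) = memV T k

set : ∀ {n} → Subset n → ℕ → Bool → Subset n
set T zero _ = T
set T (suc k) b = setV T k b

-- crystal operators e_i, f_i on a single subset (nothing = 0)
eSub : ∀ {n} → ℕ → Subset n → Maybe (Subset n)
eSub zero T = nothing
eSub (suc i) T with mem T (suc i) | mem T (suc (suc i))
... | false | true = just (set T (suc i) true)
... | true  | true = just (set T (suc (suc i)) false)
... | _     | _    = nothing

fSub : ∀ {n} → ℕ → Subset n → Maybe (Subset n)
fSub zero T = nothing
fSub (suc i) T with mem T (suc i) | mem T (suc (suc i))
... | true | false = just (set T (suc (suc i)) true)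
... | true | true  = just (set T (suc i) false)
... | _    | _     = nothing

count : ∀ {A : Set} → ℕ → (A → Maybe A) → A → ℕ
count zero op x = zero
count (suc k) op x with op x
... | nothing = zero
... | just y  = suc (count k op y)

iterM : ∀ {A : Set} → ℕ → (A → Maybe A) → A → Maybe A
iterM zero op x = just x
iterM (suc k) op x = op x >>= iterM k op

-- ε_i and φ_i of a single subset: the sup is at most 2, so fuel 3 is exact
εSub : ∀ {n} → ℕ → Subset n → ℕ
εSub i T = count 3 (eSub i) T

φSub : ∀ {n} → ℕ → Subset n → ℕ
φSub i T = count 3 (fSub i) T

-- The tensor product S₁ ⊗ (S₂ ⊗ (⋯ ⊗ Sₘ)) .  On a tensor of m factors
-- ε_i, φ_i are ≤ 2m (each e_i step raises wt_i - wt_{i+1} ∈ [-m,m] by 1),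
-- so counting with fuel 2m+1 computes the sup exactly.

record Ops (A : Set) : Set where
  field
    e f : ℕ → A → Maybe A

SVW : ℕ → ℕ → Set
SVW n m = Vec (Subset n) m

tensorOps : ∀ n m → Ops (SVW n m)
tensorOps n zero = record { e = λ _ _ → nothing ; f = λ _ _ → nothing }
tensorOps n (suc m) = record { e = eS ; f = fS }
  where
  O = tensorOps n m
  φc : ℕ → SVW n m → ℕ
  φc i c = count (suc (2 * m)) (Ops.f O i) c
  eS : ℕ → SVW n (suc m) → Maybe (SVW n (suc m))
  eS i (b ∷ c) = if εSub i b ≤ᵇ φc i c
                 then Maybe.map (b ∷_) (Ops.e O i c)
                 else Maybe.map (_∷ c) (eSub i b)
  fS : ℕ → SVW n (suc m) → Maybe (SVW n (suc m))
  fS i (b ∷ c) = if εSub i b <ᵇ φc i c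
                 then Maybe.map (b ∷_) (Ops.f O i c)
                 else Maybe.map (_∷ c) (fSub i b)

eT : ∀ {n m} → ℕ → SVW n m → Maybe (SVW n m)
eT {n} {m} = Ops.e (tensorOps n m)

fT : ∀ {n m} → ℕ → SVW n m → Maybe (SVW n m)
fT {n} {m} = Ops.f (tensorOps n m)

εT : ∀ {n m} → ℕ → SVW n m → ℕ
εT {n} {m} i S = count (suc (2 * m)) (eT i) S

φT : ∀ {n m} → ℕ → SVW n m → ℕ
φT {n} {m} i S = count (suc (2 * m)) (fT i) S

E : ∀ {n m} → ℕ → SVW n m → Maybe (SVW n m)
E i S = iterM (εT i S) (eT i) S

block : ∀ {n m} → ℕ → SVW n m → Maybe (SVW n m)
block zero S = just S
block (suc k) S = E (suc k) S >>= block k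

rectUpTo : ∀ {n m} → ℕ → SVW n m → Maybe (SVW n m)
rectUpTo zero S = just S
rectUpTo (suc k) S = rectUpTo k S >>= block (suc k)

rect : ∀ {n m} → SVW n m → Maybe (SVW n m)
rect {n} S = rectUpTo (n ∸ 1) S

-- Tableaux.  A tableau (matrix coordinates, left justified) is given by
-- its list of rows, top row first, with no empty rows at the end.

Tableau : Set
Tableau = List (List ℕ)

Aword : ∀ {n m} → SVW n m → ℕ → List ℕ
Aword {n} {m} S i =
  concatMap (λ { (j' , T) → if mem T i then [ m ∸ j' ] else [] })
            (zip (upTo m) (toList S))        -- j' = j - 1

A : ∀ {n m} → SVW n m → List ℕ
A {n} S = concatMap (λ i → Aword S (suc i)) (upTo n)

null : ∀ {X : Set} → List X → Bool
null [] = true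
null (_ ∷ _) = false

dropEmpty : List (List ℕ) → List (List ℕ)
dropEmpty [] = []
dropEmpty (r ∷ rs) = if null r then dropEmpty rs else r ∷ rs

stripTrailingEmpty : List (List ℕ) → List (List ℕ)
stripTrailingEmpty rs = reverse (dropEmpty (reverse rs))

-- tab(S): row i lists the m+1-j with i ∈ S_j in increasing order
-- (A_i lists them in decreasing order, so we reverse it)
tab : ∀ {n m} → SVW n m → Tableau
tab {n} S = stripTrailingEmpty (map (λ i → reverse (Aword S (suc i))) (upTo n))

-- Hecke insertion, on tableaux stored by columns (each column top to bottom)

strictInc : List ℕ → Bool
strictInc [] = true
strictInc (x ∷ []) = true
strictInc (x ∷ y ∷ ys) = (x <ᵇ y) ∧ strictInc (y ∷ ys)

rowsLess : List ℕ → List ℕ → Bool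
rowsLess (x ∷ xs) (y ∷ ys) = (x <ᵇ y) ∧ rowsLess xs ys
rowsLess _ _ = true

isIncreasing : List (List ℕ) → Bool
isIncreasing [] = true
isIncreasing (c ∷ []) = strictInc c ∧ not (null c)
isIncreasing (c ∷ c' ∷ cs) =
  strictInc c ∧ not (null c) ∧ (length c' ≤ᵇ length c) ∧ rowsLess c c'
  ∧ isIncreasing (c' ∷ cs)

-- position and value of the first (= smallest, columns being increasing)
-- entry y of the column with x < y
findBump : ℕ → List ℕ → Maybe (ℕ × ℕ)
findBump x [] = nothing
findBump x (y ∷ ys) =
  if x <ᵇ y then just (0 , y) else Maybe.map (λ { (p , v) → (suc p , v) }) (findBump x ys)

replaceAt : ℕ → ℕ → List ℕ → List ℕ
replaceAt _ _ [] = []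
replaceAt zero x (_ ∷ ys) = x ∷ ys
replaceAt (suc p) x (y ∷ ys) = y ∷ replaceAt p x ys

insCols : List (List ℕ) → List (List ℕ) → ℕ → List (List ℕ)
insCols done [] x =
  let T' = reverse done ++ [ [ x ] ] in
  if isIncreasing T' then T' else reverse done
insCols done (col ∷ rest) x with findBump x col
... | nothing =
  let T' = reverse done ++ (col ++ [ x ]) ∷ rest in
  if isIncreasing T' then T' else reverse done ++ col ∷ rest
... | just (p , y) =
  let col' = replaceAt p x col in
  if isIncreasing (reverse done ++ col' ∷ rest)
  then insCols (col' ∷ done) rest y
  else insCols (col ∷ done) rest y

heckeInsertCols : List (List ℕ) → ℕ → List (List ℕ)
heckeInsertCols T x = insCols [] T x

lookupL : List ℕ → ℕ → Maybe ℕ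
lookupL [] _ = nothing
lookupL (x ∷ _) zero = just x
lookupL (_ ∷ xs) (suc r) = lookupL xs r

rowAt : ℕ → List (List ℕ) → List ℕ
rowAt r [] = []
rowAt r (c ∷ cs) with lookupL c r
... | nothing = []
... | just v = v ∷ rowAt r cs

colsToRows : List (List ℕ) → Tableau
colsToRows [] = []
colsToRows (c ∷ cs) = map (λ r → rowAt r (c ∷ cs)) (upTo (length c))

Phecke : ∀ {n m} → SVW n m → Tableau
Phecke S = colsToRows (foldl heckeInsertCols [] (A S))

{-# OPTIONS --safe #-}
module Submission where

-- Let v be the largest letter.  Both sides are compatible with deleting v: a
-- larger letter never influences the insertion of smaller ones, and
-- E_i (b ⊗ c) = e_i^d b ⊗ E_i c with d = ε_i(b) ∸ φ_i(c).  So, for a single row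
-- of S inserted into the tableau of the rows above it, one inducts on the
-- letters.  What must be remembered about the smaller letters is in which
-- columns their insertions end and whether these add a box.  Among the columns
-- of each length r these are the first a with a new box, followed by at most
-- one (f = 0 or 1) without, leaving z columns untouched, and the
-- corresponding φ_i equals 2z + f.  A letter v in the tableau is pushed to the
-- right by these insertions, hence from row to row upwards, exactly as e_i^d
-- prescribes.
open import Defs
open import Data.Bool using (Bool; true; false; if_then_else_; _∧_; _∨_; not) renaming (T to True)
open import Data.Bool.Properties using (∧-identityʳ; ∧-zeroʳ; ∨-zeroʳ)
open import Data.Fin.Subset using (Subset)
open import Data.List using (List; []; _∷_; _++_; [_]; length; map; replicate; concatMap; zip; applyUpTo; upTo; reverse; foldl; _ʳ++_)
open import Data.List.Properties using (∷-injectiveˡ; ∷-injectiveʳ; length-++; length-replicate; ++-identityʳ; ʳ++-defn; unfold-reverse; reverse-involutive; reverse-++; foldl-++; upTo-∷ʳ; map-upTo; concatMap-++)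
open import Data.List.Relation.Unary.All as All using (All; []; _∷_)
open import Data.List.Relation.Unary.All.Properties using (++⁺; ∷ʳ⁺; replicate⁺; applyUpTo⁺₁; applyUpTo⁺₂)
open import Data.Maybe using (Maybe; just; nothing; _>>=_)
import Data.Maybe as Maybe
open import Data.Maybe.Properties using (just-injective)
open import Data.Nat
open import Data.Nat.Properties
open import Data.Nat.Tactic.RingSolver using (solve-∀)
open import Data.Product using (_×_; _,_; proj₁; proj₂; ∃-syntax; map₁)
open import Data.Unit using (⊤; tt)
open import Data.Vec using (Vec; []; _∷_; toList)
open import Function using (_∘_)
open import Relation.Binary.PropositionalEquality hiding ([_])
open import Relation.Nullary using (contradiction; yes; no)

-- Insertion in presence of a largest letter

-- The equation φ_i = 2z + f reflects the strings {i} → {i,i+1} → {i+1} of f_i on one subset. A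
-- letter in row i alone opens a free column for row i+1, worth two steps. A letter v in row i+1
-- alone then undergoes e_i^d with d = 2 ∸ φ_i. If d = 0, some free column lets v come to rest in
-- row i+1. If d = 1, only a failed insertion is left: by the rule of Hecke insertion it keeps v in
-- place and bumps it all the same, so v ends up in both rows. If d = 2, v leaves row i+1. When a v
-- sent up meets a v already in row i, its insertion fails; this is the only way in which a miss (f
-- = 1) arises.

Cols : Set
Cols = List (List ℕ)

<ᵇ-true : ∀ {m n} → m < n → (m <ᵇ n) ≡ true
<ᵇ-true {m} {n} p with m <ᵇ n | <⇒<ᵇ p
... | true | _ = refl

<ᵇ-false : ∀ {m n} → n ≤ m → (m <ᵇ n) ≡ false
<ᵇ-false {m} {n} p with m <ᵇ n in eq
... | false = refl
... | true = contradiction (<ᵇ⇒< m n (subst True (sym eq) tt)) (≤⇒≯ p)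

<ᵇ-true⁻¹ : ∀ {m n} → (m <ᵇ n) ≡ true → m < n
<ᵇ-true⁻¹ {m} {n} eq = <ᵇ⇒< m n (subst True (sym eq) tt)

<ᵇ-false⁻¹ : ∀ {m n} → (m <ᵇ n) ≡ false → n ≤ m
<ᵇ-false⁻¹ {m} {n} eq = ≮⇒≥ λ p → contradiction (trans (sym eq) (<ᵇ-true p)) λ ()

≤ᵇ-true : ∀ {m n} → m ≤ n → (m ≤ᵇ n) ≡ true
≤ᵇ-true {zero} _ = refl
≤ᵇ-true {suc m} le = <ᵇ-true le

≤ᵇ-true⁻¹ : ∀ {m n} → (m ≤ᵇ n) ≡ true → m ≤ n
≤ᵇ-true⁻¹ {m} {n} eq = ≤ᵇ⇒≤ m n (subst True (sym eq) tt)

≤ᵇ-false : ∀ {m n} → n < m → (m ≤ᵇ n) ≡ false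
≤ᵇ-false (s≤s lt) = <ᵇ-false lt

-- An entry outside the column c is larger than every letter, so below c p x
-- says that x fits to the right of c in position p.
below : List ℕ → ℕ → ℕ → Bool
below [] _ _ = false
below (y ∷ c) zero x = y <ᵇ x
below (y ∷ c) (suc p) x = below c p x

-- Ins L cs x cs' e g: Hecke insertion of x into the columns cs ends in column
-- e with result cs', and g tells whether a box is added.  L p x says that the
-- column to the left of cs allows x in position p.  There is no case for an
-- empty list of columns: tableaux are padded with empty columns.
data Ins : (ℕ → ℕ → Bool) → Cols → ℕ → Cols → ℕ → Bool → Set where
  stop : ∀ {L c cs x g} → findBump x c ≡ nothing →
         g ≡ strictInc (c ++ [ x ]) ∧ L (length c) x →
         Ins L (c ∷ cs) x ((if g then c ++ [ x ] else c) ∷ cs) 0 g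
  bump : ∀ {L c cs x p y ok cs' e g} → findBump x c ≡ just (p , y) →
         ok ≡ strictInc (replaceAt p x c) ∧ L p x →
         Ins (below (if ok then replaceAt p x c else c)) cs y cs' e g →
         Ins L (c ∷ cs) x ((if ok then replaceAt p x c else c) ∷ cs') (suc e) g

addLetter : ℕ → List Bool → Cols → Cols
addLetter v (b ∷ bs) (c ∷ cs) = (if b then c ++ [ v ] else c) ∷ addLetter v bs cs
addLetter v _ cs = cs

-- Up ls V e g V' e' g': if an insertion into columns of lengths ls ends in
-- column e with outcome g, then in presence of a further, largest letter in
-- the columns V it ends in e' with outcome g' and leaves that letter in V'.
-- In the case move the largest letter is bumped into the next column.
data Up : List ℕ → List Bool → ℕ → Bool → List Bool → ℕ → Bool → Set where
  stay : ∀ {l ls V g} → Up (l ∷ ls) (false ∷ V) 0 g (false ∷ V) 0 g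
  -- The largest letter would land in position l₂ of the next column and needs a smaller entry to
  -- its left. Apart from that letter, the left column has suc l entries if the inserted letter took
  -- its place, and l if it stayed.
  move : ∀ {l l₂ ls w V g legal} → legal ≡ (l₂ <ᵇ (if g then suc l else l)) →
         Up (l ∷ l₂ ∷ ls) (true ∷ w ∷ V) 0 g (not g ∷ (w ∨ legal) ∷ V) 1 (not w ∧ legal)
  later : ∀ {l ls w V e g V' e' g'} → Up ls V e g V' e' g' →
         Up (l ∷ ls) (w ∷ V) (suc e) g (w ∷ V') (suc e') g'

findBump-none-snoc : ∀ {x v} c → findBump x c ≡ nothing → x < v →
  findBump x (c ++ [ v ]) ≡ just (length c , v)
findBump-none-snoc [] eq x<v rewrite <ᵇ-true x<v = refl
findBump-none-snoc {x} {v} (y ∷ c) eq x<v with x <ᵇ y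
... | false with findBump x c in eq'
... | nothing rewrite findBump-none-snoc c eq' x<v = refl

findBump-just-snoc : ∀ {x v r} c → findBump x c ≡ just r → findBump x (c ++ [ v ]) ≡ just r
findBump-just-snoc {x} {v} (y ∷ c) eq with x <ᵇ y
... | true = eq
... | false with findBump x c in eq'
... | just _ rewrite findBump-just-snoc {v = v} c eq' = eq

findBump-max : ∀ {v} c → All (_≤ v) c → findBump v c ≡ nothing
findBump-max [] [] = refl
findBump-max (y ∷ c) (p ∷ ps) rewrite <ᵇ-false p | findBump-max c ps = refl

replaceAt-length : ∀ x v c → replaceAt (length c) x (c ++ [ v ]) ≡ c ++ [ x ]
replaceAt-length x v [] = refl
replaceAt-length x v (y ∷ c) = cong (y ∷_) (replaceAt-length x v c)

data Bump (x : ℕ) : List ℕ → ℕ → ℕ → Set where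
  here : ∀ {y c} → x < y → Bump x (y ∷ c) 0 y
  there : ∀ {z c p y} → z ≤ x → Bump x c p y → Bump x (z ∷ c) (suc p) y

findBump-view : ∀ {x p y} c → findBump x c ≡ just (p , y) → Bump x c p y
findBump-view {x} (z ∷ c) eq with x <ᵇ z in lt
findBump-view {x} (z ∷ c) refl | true = here (<ᵇ-true⁻¹ lt)
findBump-view {x} (z ∷ c) eq | false with findBump x c in eq'
findBump-view {x} (z ∷ c) refl | false | just _ = there (<ᵇ-false⁻¹ lt) (findBump-view c eq')

replaceAt-snoc : ∀ {x v c p y} → Bump x c p y → replaceAt p x (c ++ [ v ]) ≡ replaceAt p x c ++ [ v ]
replaceAt-snoc (here _) = refl
replaceAt-snoc (there {z} _ b) = cong (z ∷_) (replaceAt-snoc b)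

bump-All : ∀ {P : ℕ → Set} {x c p y} → Bump x c p y → All P c → P y
bump-All (here _) (p ∷ _) = p
bump-All (there _ b) (_ ∷ ps) = bump-All b ps

replaceAt-All : ∀ {P : ℕ → Set} {x} p c → P x → All P c → All P (replaceAt p x c)
replaceAt-All p [] px [] = []
replaceAt-All zero (_ ∷ _) px (_ ∷ ps) = px ∷ ps
replaceAt-All (suc p) (_ ∷ c) px (q ∷ ps) = q ∷ replaceAt-All p c px ps

replaceAt-length′ : ∀ {x} p c → length (replaceAt p x c) ≡ length c
replaceAt-length′ p [] = refl
replaceAt-length′ zero (_ ∷ _) = refl
replaceAt-length′ (suc p) (_ ∷ c) = cong suc (replaceAt-length′ p c)

strictInc-snoc : ∀ {v} c → All (_< v) c → strictInc (c ++ [ v ]) ≡ strictInc c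
strictInc-snoc [] [] = refl
strictInc-snoc (x ∷ []) (p ∷ []) rewrite <ᵇ-true p = refl
strictInc-snoc (x ∷ y ∷ c) (p ∷ ps) = cong ((x <ᵇ y) ∧_) (strictInc-snoc (y ∷ c) ps)

strictInc-dup : ∀ v c → strictInc ((c ++ [ v ]) ++ [ v ]) ≡ false
strictInc-dup v [] rewrite <ᵇ-false (≤-refl {v}) = refl
strictInc-dup v (x ∷ []) rewrite <ᵇ-false (≤-refl {v}) = ∧-zeroʳ _
strictInc-dup v (x ∷ y ∷ c) rewrite strictInc-dup v (y ∷ c) = ∧-zeroʳ _

below-snoc : ∀ {y v} c p → y < v → below (c ++ [ v ]) p y ≡ below c p y
below-snoc [] zero y<v = <ᵇ-false (<⇒≤ y<v)
below-snoc [] (suc p) y<v = refl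
below-snoc (x ∷ c) zero y<v = refl
below-snoc (x ∷ c) (suc p) y<v = below-snoc c p y<v

below-max : ∀ {v} c p → All (_< v) c → below c p v ≡ (p <ᵇ length c)
below-max [] zero [] = refl
below-max [] (suc p) [] = refl
below-max (x ∷ c) zero (q ∷ _) = <ᵇ-true q
below-max (x ∷ c) (suc p) (_ ∷ qs) = below-max c p qs

below-max-snoc : ∀ {v} c p → All (_< v) c → below (c ++ [ v ]) p v ≡ (p <ᵇ length c)
below-max-snoc {v} [] zero [] = <ᵇ-false (≤-refl {v})
below-max-snoc [] (suc p) [] = refl
below-max-snoc (x ∷ c) zero (q ∷ _) = <ᵇ-true q
below-max-snoc (x ∷ c) (suc p) (_ ∷ qs) = below-max-snoc c p qs

length-snoc : ∀ (c : List ℕ) x → length (c ++ [ x ]) ≡ suc (length c)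
length-snoc c x = trans (length-++ c) (+-comm (length c) 1)

Below : ℕ → List ℕ → Set
Below v c = strictInc c ≡ true × All (_< v) c

-- Nothing exceeds v, so its insertion ends at once. If the column already contains v, a second copy
-- breaks strictness, but v is there anyway; hence `w ∨ legal` for the content and `not w ∧ legal`
-- for the outcome.
insert-largest : ∀ {v L legal} w {V} c cs → Below v c → legal ≡ L (length c) v →
  Ins L (addLetter v (w ∷ V) (c ∷ cs)) v (addLetter v ((w ∨ legal) ∷ V) (c ∷ cs)) 0 (not w ∧ legal)
insert-largest {v} {L} false c cs (s , a) refl =
  stop (findBump-max c (All.map <⇒≤ a)) (sym (cong (_∧ L (length c) v) (trans (strictInc-snoc c a) s)))
insert-largest {v} {L} true c cs (s , a) refl =
  stop (findBump-max (c ++ [ v ]) (++⁺ (All.map <⇒≤ a) (≤-refl ∷ []))) (sym (cong (_∧ L (length (c ++ [ v ])) v) (strictInc-dup v c)))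

-- For a letter below v, a left neighbour v is as forbidding as an empty position, so all tests on
-- smaller letters have the same answer with and without v. The two insertions differ only from the
-- column where the smaller one ends, because there v, if present, is bumped.
lift : ∀ {v L L⁺ cs x cs' e g ls V V' e' g'} →
  (∀ p y → y < v → L⁺ p y ≡ L p y) → All (Below v) cs → x < v →
  Ins L cs x cs' e g → Up ls V e g V' e' g' → ls ≡ map length cs →
  Ins L⁺ (addLetter v V cs) x (addLetter v V' cs') e' g'
lift hL (_ ∷ _) x<v (stop {c = c} {x = x} fb geq) stay _ =
  stop fb (trans geq (cong (strictInc (c ++ [ x ]) ∧_) (sym (hL _ x x<v))))
lift {v} {L⁺ = L⁺} hL ((s , a) ∷ cv₂@(_ ∷ _)) x<v (stop {c = c} {cs = c₂ ∷ cs} {x = x} {g = true} fb geq) (move {w = w} leq) refl =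
  subst (λ d → Ins L⁺ _ x (d ∷ _) 1 _) lem
    (bump {ok = true} (findBump-none-snoc c fb x<v)
       (trans geq (cong₂ _∧_ (cong strictInc (sym (replaceAt-length x v c))) (sym (hL _ x x<v))))
       (insert-largest w c₂ cs (All.head cv₂) (trans leq (trans (cong (length c₂ <ᵇ_) (sym (length-snoc c x)))
         (trans (sym (below-max (c ++ [ x ]) (length c₂) (++⁺ a (x<v ∷ [])))) (cong (λ d → below d (length c₂) v) (sym lem)))))))
  where lem = replaceAt-length x v c
lift {v} hL ((s , a) ∷ cv₂@(_ ∷ _)) x<v (stop {c = c} {cs = c₂ ∷ cs} {x = x} {g = false} fb geq) (move {w = w} leq) refl =
  bump {ok = false} (findBump-none-snoc c fb x<v)
    (trans geq (cong₂ _∧_ (cong strictInc (sym (replaceAt-length x v c))) (sym (hL _ x x<v))))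
    (insert-largest w c₂ cs (All.head cv₂) (trans leq (sym (below-max-snoc c (length c₂) a))))
lift {v} {L = L} {L⁺ = L⁺} hL ((s , a) ∷ cvs) x<v (bump {c = c} {cs = cs} {x = x} {p = p} {y} {ok = ok} {cs'} {e} {g} fb okeq ins) (later {w = w} {V = V} {V' = V'} up) leneq =
  go w
  where
  b = findBump-view c fb
  y<v = bump-All b a
  a' = replaceAt-All p c x<v a
  c' = if ok then replaceAt p x c else c
  go : ∀ w → Ins L⁺ (addLetter v (w ∷ V) (c ∷ cs)) x (addLetter v (w ∷ V') (c' ∷ cs')) (suc _) _
  go false = bump fb (trans okeq (cong (strictInc (replaceAt p x c) ∧_) (sym (hL _ x x<v))))
    (lift (λ _ _ _ → refl) cvs y<v ins up (∷-injectiveʳ leneq))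
  go true = subst (λ d → Ins L⁺ _ x (d ∷ _) _ _) (lem ok)
    (bump {ok = ok} (findBump-just-snoc c fb)
      (trans okeq (cong₂ _∧_ (trans (sym (strictInc-snoc (replaceAt p x c) a')) (cong strictInc (sym (replaceAt-snoc b)))) (sym (hL _ x x<v))))
      (lift (λ q z z<v → trans (cong (λ d → below d q z) (lem ok)) (below-snoc c' q z<v)) cvs y<v ins up (∷-injectiveʳ leneq)))
    where
    lem : ∀ ok → (if ok then replaceAt p x (c ++ [ v ]) else c ++ [ v ]) ≡ (if ok then replaceAt p x c else c) ++ [ v ]
    lem false = refl
    lem true = replaceAt-snoc b

-- The list records where, and with which outcome, each insertion ends.
data Run : Cols → List ℕ → Cols → List (ℕ × Bool) → Set where
  [] : ∀ {T} → Run T [] T []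
  _∷_ : ∀ {T x T₁ e g w T' ts} → Ins (λ _ _ → true) T x T₁ e g → Run T₁ w T' ts →
        Run T (x ∷ w) T' ((e , g) ∷ ts)

inc : List ℕ → ℕ → Bool → List ℕ
inc [] _ _ = []
inc (l ∷ ls) zero g = (if g then suc l else l) ∷ ls
inc (l ∷ ls) (suc e) g = l ∷ inc ls e g

ins-lengths : ∀ {L cs x cs' e g} → Ins L cs x cs' e g → map length cs' ≡ inc (map length cs) e g
ins-lengths (stop {c = c} {x = x} {g = true} _ _) = cong (_∷ _) (length-snoc c x)
ins-lengths (stop {g = false} _ _) = refl
ins-lengths (bump {c = c} {p = p} {ok = true} _ _ i) = cong₂ _∷_ (replaceAt-length′ p c) (ins-lengths i)
ins-lengths (bump {ok = false} _ _ i) = cong (_ ∷_) (ins-lengths i)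

∧-true : ∀ a {b} → a ∧ b ≡ true → a ≡ true × b ≡ true
∧-true true eq = refl , eq

ins-Below : ∀ {v L cs x cs' e g} → x < v → All (Below v) cs → Ins L cs x cs' e g → All (Below v) cs'
ins-Below x<v (cv ∷ cvs) (stop {g = false} _ _) = cv ∷ cvs
ins-Below x<v ((_ , a) ∷ cvs) (stop {g = true} _ eq) = (proj₁ (∧-true _ (sym eq)) , ++⁺ a (x<v ∷ [])) ∷ cvs
ins-Below x<v (cv@(_ , a) ∷ cvs) (bump {c = c} {ok = false} fb _ i) =
  cv ∷ ins-Below (bump-All (findBump-view c fb) a) cvs i
ins-Below x<v ((_ , a) ∷ cvs) (bump {c = c} {p = p} {ok = true} fb eq i) =
  (proj₁ (∧-true _ (sym eq)) , replaceAt-All p c x<v a) ∷ ins-Below (bump-All (findBump-view c fb) a) cvs i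

data Ups : List ℕ → List Bool → List (ℕ × Bool) → List Bool → List (ℕ × Bool) → Set where
  [] : ∀ {ls V} → Ups ls V [] V []
  _∷_ : ∀ {ls V e g V₁ e₁ g₁ ts V' ts'} → Up ls V e g V₁ e₁ g₁ → Ups (inc ls e g) V₁ ts V' ts' →
        Ups ls V ((e , g) ∷ ts) V' ((e₁ , g₁) ∷ ts')

lift-run : ∀ {v T w T' ts ls V V' ts'} → All (Below v) T → All (_< v) w → Run T w T' ts →
  Ups ls V ts V' ts' → ls ≡ map length T → Run (addLetter v V T) w (addLetter v V' T') ts'
lift-run cvs [] [] [] _ = []
lift-run cvs (x<v ∷ ps) (i ∷ run) (u ∷ us) refl =
  lift (λ _ _ _ → refl) cvs x<v i u refl ∷
  lift-run (ins-Below x<v cvs i) ps run us (sym (ins-lengths i))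

-- A column is labelled by the outcome of the insertion ending in it, if any.
Label : Set
Label = Maybe Bool

shift : List (ℕ × Bool) → List (ℕ × Bool)
shift = map (map₁ suc)

ending : Label → List (ℕ × Bool)
ending nothing = []
ending (just g) = (0 , g) ∷ []

endings : List Label → List (ℕ × Bool)
endings [] = []
endings (d ∷ ds) = ending d ++ shift (endings ds)

-- The composition of the updates Up of a whole word, computed in one pass from
-- left to right; this is possible because the insertions of a decreasing word
-- end further and further to the right.  In Scan a ls V D V' D', the label a
-- is that of an insertion moved into the first column from its left.
data Scan : Label → List ℕ → List Bool → List Label → List Bool → List Label → Set where
  [] : Scan nothing [] [] [] [] []
  idle : ∀ {a l ls w V D V' D'} → Scan nothing ls V D V' D' →
         Scan a (l ∷ ls) (w ∷ V) (nothing ∷ D) (w ∷ V') (a ∷ D')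
  stay : ∀ {l ls V D V' D' g} → Scan nothing ls V D V' D' →
         Scan nothing (l ∷ ls) (false ∷ V) (just g ∷ D) (false ∷ V') (just g ∷ D')
  move : ∀ {a l l₂ ls w V D V' D' g legal} → legal ≡ (l₂ <ᵇ (if g then suc l else l)) →
         Scan (just (not w ∧ legal)) (l₂ ∷ ls) ((w ∨ legal) ∷ V) D V' D' →
         Scan a (l ∷ l₂ ∷ ls) (true ∷ w ∷ V) (just g ∷ D) (not g ∷ V') (a ∷ D')

ups-shift : ∀ {l ls w V ts V' ts'} → Ups ls V ts V' ts' →
  Ups (l ∷ ls) (w ∷ V) (shift ts) (w ∷ V') (shift ts')
ups-shift [] = []
ups-shift (u ∷ us) = later u ∷ ups-shift us

scan-ups : ∀ {a ls V D V' D'} → Scan a ls V D V' D' →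
  ∃[ ts' ] Ups ls V (endings D) V' ts' × endings D' ≡ ending a ++ ts'
scan-ups [] = [] , [] , refl
scan-ups (idle {a = a} sc) with _ , us , refl ← scan-ups sc = _ , ups-shift us , refl
scan-ups (stay {g = g} sc) with _ , us , refl ← scan-ups sc = _ , stay ∷ ups-shift us , refl
scan-ups (move {a = a} leq sc) with ts' , us , eq ← scan-ups sc =
  _ , move leq ∷ ups-shift us , cong (λ ts → ending a ++ shift ts) eq

lift-word : ∀ {v T w T' D V V' D'} → All (Below v) T → All (_< v) w → Run T w T' (endings D) →
  Scan nothing (map length T) V D V' D' → Run (addLetter v V T) w (addLetter v V' T') (endings D')
lift-word cvs ps run sc with _ , us , refl ← scan-ups sc = lift-run cvs ps run us refl

-- The largest letter is inserted first, and ends in the first column.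
lift-word∷ : ∀ {v c T w T' D u V V' D'} → All (Below v) (c ∷ T) → All (_< v) w →
  Run (c ∷ T) w T' (endings D) → Scan (just (not u)) (map length (c ∷ T)) (true ∷ V) D V' D' →
  Run (addLetter v (u ∷ V) (c ∷ T)) (v ∷ w) (addLetter v V' T') (endings D')
lift-word∷ {v} {c} {T} {w} {T'} {u = u} {V} {V'} cvs@(cv ∷ _) ps run sc with ts' , us , eq ← scan-ups sc =
  subst (Run (addLetter v (u ∷ V) (c ∷ T)) (v ∷ w) (addLetter v V' T')) (sym eq)
    (subst₂ (λ b g → Ins (λ _ _ → true) (addLetter v (u ∷ V) (c ∷ T)) v (addLetter v (b ∷ V) (c ∷ T)) 0 g)
      (∨-zeroʳ u) (∧-identityʳ (not u)) (insert-largest u c T cv refl)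
     ∷ lift-run cvs ps run us refl)

-- Agreement with heckeInsertCols

data Link : List ℕ → List ℕ → Set where
  [] : ∀ {d} → Link d []
  _∷_ : ∀ {z d y c} → (z <ᵇ y) ≡ true → Link d c → Link (z ∷ d) (y ∷ c)

link-rowsLess : ∀ {d c} → Link d c → rowsLess d c ≡ true
link-rowsLess {[]} [] = refl
link-rowsLess {_ ∷ _} [] = refl
link-rowsLess (lt ∷ l) rewrite lt = link-rowsLess l

link-length : ∀ {d c} → Link d c → length c ≤ length d
link-length [] = z≤n
link-length (_ ∷ l) = s≤s (link-length l)

rowsLess-link : ∀ d c → length c ≤ length d → rowsLess d c ≡ true → Link d c
rowsLess-link d [] _ _ = []
rowsLess-link (z ∷ d) (y ∷ c) (s≤s le) eq with z <ᵇ y in lt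
... | true = lt ∷ rowsLess-link d c le eq

replace-link : ∀ {x c p y d} → Bump x c p y → Link d c → below d p x ≡ true → Link d (replaceAt p x c)
replace-link (here _) (_ ∷ l) lt = lt ∷ l
replace-link (there _ b) (q ∷ l) lt = q ∷ replace-link b l lt

replace-link⁻¹ : ∀ {x c p y d} → Bump x c p y → Link d (replaceAt p x c) → below d p x ≡ true
replace-link⁻¹ (here _) (lt ∷ _) = lt
replace-link⁻¹ (there _ b) (_ ∷ l) = replace-link⁻¹ b l

append-link : ∀ {x c d} → Link d c → below d (length c) x ≡ true → Link d (c ++ [ x ])
append-link {c = []} {_ ∷ _} [] lt = lt ∷ []
append-link (q ∷ l) lt = q ∷ append-link l lt

append-link⁻¹ : ∀ {x} c {d} → Link d (c ++ [ x ]) → below d (length c) x ≡ true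
append-link⁻¹ [] (lt ∷ _) = lt
append-link⁻¹ (_ ∷ c) (_ ∷ l) = append-link⁻¹ c l

-- The new entry is smaller than the bumped one, so the inequalities with the column to the right
-- survive. This is why only the left neighbour has to be tested.
link-replace : ∀ {x c p y c₂} → Bump x c p y → Link c c₂ → Link (replaceAt p x c) c₂
link-replace b [] = []
link-replace (here {y} lt) (_∷_ {y = y₂} q l) = <ᵇ-true (<-trans lt (<ᵇ-true⁻¹ {y} {y₂} q)) ∷ l
link-replace (there _ b) (q ∷ l) = q ∷ link-replace b l

link-append : ∀ {x c c₂} → Link c c₂ → Link (c ++ [ x ]) c₂
link-append [] = []
link-append (q ∷ l) = q ∷ link-append l

LeftLink : Cols → List ℕ → Set
LeftLink [] c = ⊤
LeftLink (d ∷ _) c = Link d c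

left : Cols → ℕ → ℕ → Bool
left [] = λ _ _ → true
left (d ∷ _) = below d

record Fits (lefts : Cols) (c : List ℕ) : Set where
  constructor fits
  field
    strict : strictInc c ≡ true
    nonempty : null c ≡ false
    linked : LeftLink lefts c

-- Good lefts cs: the columns cs form an increasing tableau to the right of the
-- columns lefts, which are listed from right to left.
data Good : Cols → Cols → Set where
  [] : ∀ {lefts} → Good lefts []
  _∷_ : ∀ {lefts c cs} → Fits lefts c → Good (c ∷ lefts) cs → Good lefts (c ∷ cs)

data GoodLeft : Cols → Set where
  [] : GoodLeft []
  _∷_ : ∀ {c lefts} → Fits lefts c → GoodLeft lefts → GoodLeft (c ∷ lefts)

both : ∀ {a b} → a ≡ true → b ≡ true → a ∧ b ≡ true
both refl eq = eq

good⇒inc : ∀ {lefts cs} → Good lefts cs → isIncreasing cs ≡ true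
good⇒inc [] = refl
good⇒inc (fits s n _ ∷ []) = both s (cong not n)
good⇒inc (fits s n _ ∷ g@(fits _ _ l ∷ _)) =
  both s (both (cong not n) (both (≤ᵇ-true (link-length l)) (both (link-rowsLess l) (good⇒inc g))))

not-≡true : ∀ {a} → not a ≡ true → a ≡ false
not-≡true {false} _ = refl

inc⇒good : ∀ {lefts} c cs → LeftLink lefts c → isIncreasing (c ∷ cs) ≡ true → Good lefts (c ∷ cs)
inc⇒good c [] l eq with s , n ← ∧-true (strictInc c) eq = fits s (not-≡true n) l ∷ []
inc⇒good c (c₂ ∷ cs) l eq
  with s , eq ← ∧-true (strictInc c) eq
  with n , eq ← ∧-true (not (null c)) eq
  with le , eq ← ∧-true (length c₂ ≤ᵇ length c) eq
  with r , eq ← ∧-true (rowsLess c c₂) eq =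
  fits s (not-≡true n) l ∷ inc⇒good c₂ cs (rowsLess-link c c₂ (≤ᵇ-true⁻¹ le) r) eq

good-ʳ++ : ∀ {lefts cs} → GoodLeft lefts → Good lefts cs → Good [] (lefts ʳ++ cs)
good-ʳ++ [] g = g
good-ʳ++ (f ∷ gl) g = good-ʳ++ gl (f ∷ g)

good-ʳ++⁻¹ : ∀ lefts {cs} → Good [] (lefts ʳ++ cs) → Good lefts cs
good-ʳ++⁻¹ [] g = g
good-ʳ++⁻¹ (d ∷ lefts) g with _ ∷ g' ← good-ʳ++⁻¹ lefts g = g'

inc⇒good[] : ∀ cs → isIncreasing cs ≡ true → Good [] cs
inc⇒good[] [] eq = []
inc⇒good[] (c ∷ cs) eq = inc⇒good c cs tt eq

true-iff : ∀ {a b} → (a ≡ true → b ≡ true) → (b ≡ true → a ≡ true) → a ≡ b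
true-iff {false} {false} _ _ = refl
true-iff {true} f _ = sym (f refl)
true-iff {false} {true} _ g = g refl

-- The global test for an increasing tableau reduces to a test of the changed
-- column and its left neighbour.
inc-test : ∀ {lefts c cs ok} → GoodLeft lefts → (ok ≡ true → Good lefts (c ∷ cs)) → (Fits lefts c → ok ≡ true) →
  isIncreasing (reverse lefts ++ c ∷ cs) ≡ ok
inc-test {lefts} {c} {cs} gl to from = trans (cong isIncreasing (sym (ʳ++-defn lefts))) (true-iff
  (λ eq → from (fits-of (good-ʳ++⁻¹ lefts (inc⇒good[] (lefts ʳ++ (c ∷ cs)) eq))))
  (λ ok → good⇒inc (good-ʳ++ gl (to ok))))
  where
  fits-of : Good lefts (c ∷ cs) → Fits lefts c
  fits-of (f ∷ _) = f

good-neighbour : ∀ {c lefts lefts' cs} → Good (c ∷ lefts) cs → Good (c ∷ lefts') cs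
good-neighbour [] = []
good-neighbour (fits s n l ∷ g) = fits s n l ∷ good-neighbour g

good-change : ∀ {lefts c c' cs} → (∀ {c₂} → Link c c₂ → Link c' c₂) → Good (c ∷ lefts) cs → Good (c' ∷ lefts) cs
good-change f [] = []
good-change f (fits s n l ∷ g) = fits s n (f l) ∷ good-neighbour g

null-append : ∀ (c : List ℕ) {x} → null (c ++ [ x ]) ≡ false
null-append [] = refl
null-append (_ ∷ _) = refl

null-replace : ∀ {x c p y} → Bump x c p y → null (replaceAt p x c) ≡ false
null-replace (here _) = refl
null-replace (there _ _) = refl

LeftLink-append : ∀ lefts {c x} → LeftLink lefts c → left lefts (length c) x ≡ true → LeftLink lefts (c ++ [ x ])
LeftLink-append [] l eq = tt
LeftLink-append (_ ∷ _) l eq = append-link l eq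

LeftLink-append⁻¹ : ∀ lefts c {x} → LeftLink lefts (c ++ [ x ]) → left lefts (length c) x ≡ true
LeftLink-append⁻¹ [] c l = refl
LeftLink-append⁻¹ (_ ∷ _) c l = append-link⁻¹ c l

LeftLink-replace : ∀ lefts {x c p y} → Bump x c p y → LeftLink lefts c → left lefts p x ≡ true → LeftLink lefts (replaceAt p x c)
LeftLink-replace [] b l eq = tt
LeftLink-replace (_ ∷ _) b l eq = replace-link b l eq

LeftLink-replace⁻¹ : ∀ lefts {x c p y} → Bump x c p y → LeftLink lefts (replaceAt p x c) → left lefts p x ≡ true
LeftLink-replace⁻¹ [] b l = refl
LeftLink-replace⁻¹ (_ ∷ _) b l = replace-link⁻¹ b l

append-test : ∀ {lefts c cs x} → GoodLeft lefts → LeftLink lefts c → Good (c ∷ lefts) cs →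
  isIncreasing (reverse lefts ++ (c ++ [ x ]) ∷ cs) ≡ strictInc (c ++ [ x ]) ∧ left lefts (length c) x
append-test {lefts} {c} gl l g = inc-test gl
  (λ ok → let s , lt = ∧-true _ ok in fits s (null-append c) (LeftLink-append lefts l lt) ∷ good-change link-append g)
  (λ { (fits s _ l') → cong₂ _∧_ s (LeftLink-append⁻¹ lefts c l') })

replace-test : ∀ {lefts c cs x p y} → GoodLeft lefts → Bump x c p y → LeftLink lefts c → Good (c ∷ lefts) cs →
  isIncreasing (reverse lefts ++ replaceAt p x c ∷ cs) ≡ strictInc (replaceAt p x c) ∧ left lefts p x
replace-test {lefts} gl b l g = inc-test gl
  (λ ok → let s , lt = ∧-true _ ok in fits s (null-replace b) (LeftLink-replace lefts b l lt) ∷ good-change (link-replace b) g)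
  (λ { (fits s _ l') → cong₂ _∧_ s (LeftLink-replace⁻¹ lefts b l') })

Padded : Cols → Cols → Set
Padded T cols = ∃[ p ] T ≡ cols ++ replicate p []

leftLink-[] : ∀ lefts → LeftLink lefts []
leftLink-[] [] = tt
leftLink-[] (_ ∷ _) = []

-- Running off the end of `cols` corresponds to `stop` in the first padding column, since an empty
-- column bumps nothing. A box added there turns one padding column into a genuine one.
ins-insCols : ∀ {T x T' e g} lefts cols → Ins (left lefts) T x T' e g → Padded T cols → GoodLeft lefts → Good lefts cols →
  ∃[ cols' ] Padded T' cols' × insCols lefts cols x ≡ lefts ʳ++ cols' × Good lefts cols'
ins-insCols lefts [] (bump () _ _) (suc p , refl) gl g
ins-insCols lefts [] (stop {x = x} {g = true} _ geq) (suc p , refl) gl g =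
  [ x ] ∷ [] , (p , refl) ,
  trans (cong (λ b → if b then reverse lefts ++ [ [ x ] ] else reverse lefts) test) (sym (ʳ++-defn lefts)) ,
  good-ʳ++⁻¹ lefts (inc⇒good[] _ (trans (cong isIncreasing (ʳ++-defn lefts)) test))
  where
  test : isIncreasing (reverse lefts ++ [ [ x ] ]) ≡ true
  test = trans (append-test gl (leftLink-[] lefts) []) (sym geq)
ins-insCols lefts [] (stop {x = x} {g = false} _ geq) (suc p , refl) gl g =
  [] , (suc p , refl) ,
  trans (cong (λ b → if b then reverse lefts ++ [ [ x ] ] else reverse lefts) test) (trans (sym (++-identityʳ _)) (sym (ʳ++-defn lefts))) , []
  where
  test : isIncreasing (reverse lefts ++ [ [ x ] ]) ≡ false
  test = trans (append-test gl (leftLink-[] lefts) []) (sym geq)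
ins-insCols lefts (c ∷ cs) (stop {x = x} {g = true} fb geq) (p , refl) gl (f ∷ g) rewrite fb =
  (c ++ [ x ]) ∷ cs , (p , refl) ,
  trans (cong (λ b → if b then reverse lefts ++ (c ++ [ x ]) ∷ cs else reverse lefts ++ c ∷ cs) test) (sym (ʳ++-defn lefts)) ,
  good-ʳ++⁻¹ lefts (inc⇒good[] _ (trans (cong isIncreasing (ʳ++-defn lefts)) test))
  where
  test : isIncreasing (reverse lefts ++ (c ++ [ x ]) ∷ cs) ≡ true
  test = trans (append-test gl (Fits.linked f) g) (sym geq)
ins-insCols lefts (c ∷ cs) (stop {x = x} {g = false} fb geq) (p , refl) gl (f ∷ g) rewrite fb =
  c ∷ cs , (p , refl) ,
  trans (cong (λ b → if b then reverse lefts ++ (c ++ [ x ]) ∷ cs else reverse lefts ++ c ∷ cs)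
    (trans (append-test gl (Fits.linked f) g) (sym geq))) (sym (ʳ++-defn lefts)) ,
  f ∷ g
ins-insCols lefts (c ∷ cs) (bump {x = x} {p = q} {y} {ok = true} fb okeq i) (p , refl) gl (f ∷ g) rewrite fb
  with f' ∷ g' ← good-ʳ++⁻¹ lefts (inc⇒good[] (lefts ʳ++ replaceAt q x c ∷ cs)
         (trans (cong isIncreasing (ʳ++-defn lefts)) (trans (replace-test gl (findBump-view c fb) (Fits.linked f) g) (sym okeq))))
  with cols' , (p' , eq) , ins≡ , good ← ins-insCols (replaceAt q x c ∷ lefts) cs i (p , refl) (f' ∷ gl) g' =
  replaceAt q x c ∷ cols' , (p' , cong (replaceAt q x c ∷_) eq) ,
  trans (cong (λ b → if b then insCols (replaceAt q x c ∷ lefts) cs y else insCols (c ∷ lefts) cs y)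
    (trans (replace-test gl (findBump-view c fb) (Fits.linked f) g) (sym okeq))) ins≡ ,
  f' ∷ good
ins-insCols lefts (c ∷ cs) (bump {x = x} {p = q} {y} {ok = false} fb okeq i) (p , refl) gl (f ∷ g) rewrite fb
  with cols' , (p' , eq) , ins≡ , good ← ins-insCols (c ∷ lefts) cs i (p , refl) (f ∷ gl) g =
  c ∷ cols' , (p' , cong (c ∷_) eq) ,
  trans (cong (λ b → if b then insCols (replaceAt q x c ∷ lefts) cs y else insCols (c ∷ lefts) cs y)
    (trans (replace-test gl (findBump-view c fb) (Fits.linked f) g) (sym okeq))) ins≡ ,
  f ∷ good

run-foldl : ∀ {T w T' ts cols} → Run T w T' ts → Padded T cols → Good [] cols →
  Padded T' (foldl heckeInsertCols cols w) × Good [] (foldl heckeInsertCols cols w)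
run-foldl [] pd g = pd , g
run-foldl {cols = cols} (i ∷ run) pd g
  with cols' , pd' , refl , g' ← ins-insCols [] cols i pd [] g = run-foldl run pd' g'

-- Insertion of a decreasing word, row by row

bit : Bool → ℕ
bit b = if b then 1 else 0

-- Let λ be the shape of a tableau with rows 0, …, k-1, into which a decreasing
-- word is inserted.  The columns c with λ_r ≤ c < λ_(r-1) are those of length
-- r; insertions end in them as follows: a times with a new box, then once
-- without if f is true, and never in the last z of them.  The rows are listed
-- from the bottom (row k, empty before the insertion) to the top (row 0, which
-- is bounded by the number of columns, padding included).
data Rows : ℕ → Set where
  top : (a z : ℕ) → Rows 0
  row : ∀ {k} (a : ℕ) (f : Bool) (z : ℕ) → Rows k → Rows (suc k)

gaps : ∀ {k} → Rows k → Vec ℕ (suc k)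
gaps (top a z) = (a + z) ∷ []
gaps (row a f z R) = (a + (bit f + z)) ∷ gaps R

labels : ∀ {k} → Rows k → List Label
labels (top a z) = replicate a (just true) ++ (replicate z nothing ++ [])
labels (row a f z R) =
  replicate a (just true) ++ (replicate (bit f) (just false) ++ (replicate z nothing ++ labels R))

heights : ∀ {k} → Vec ℕ k → List ℕ
heights [] = []
heights {suc k} (g ∷ gs) = replicate g k ++ heights gs

-- A new largest letter in row r is in the leftmost of the columns of length r.
first : Bool → ℕ → List Bool
first b zero = []
first b (suc g) = b ∷ replicate g false

corners : ∀ {k} → Vec ℕ k → Vec Bool k → List Bool
corners [] [] = []
corners (g ∷ gs) (b ∷ bs) = first b g ++ corners gs bs

-- The corners of the tableau after the insertion.
corners′ : ∀ {k} → Rows k → Vec Bool (suc k) → List Bool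
corners′ (top a z) (b ∷ []) = replicate a false ++ (first b z ++ [])
corners′ (row a f z R) (b ∷ bs) = replicate a false ++ (first b (bit f + z) ++ corners′ R bs)

-- While the largest letter v moves from the bottom row up: there is no v in the
-- current row, or it was in this row before (some false), or it was pushed
-- there from the row below (some true).
data Origin : Set where
  none : Origin
  some : (pushed : Bool) → Origin

next : Bool → Origin → Origin
next b o = if b then some false else o

-- How the data of an insertion change when a largest letter v is added to the
-- tableau in the rows bs: rows R become R', and v ends in the rows bs'.
data Step : ∀ {k} → Origin → Rows k → Vec Bool k → Rows k → Vec Bool (suc k) → Set where
  top-none : ∀ {a z} → Step none (top a z) [] (top a z) (false ∷ [])
  top-some : ∀ {p a z} → Step (some p) (top a (suc z)) [] (top (bit p + a) z) (true ∷ [])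
  -- If v lies in the next row up, it lengthens a column there, which joins the present group as a
  -- last, untouched column: hence `z + bit b`.
  absent : ∀ {k a f z b} {R R' : Rows k} {bs bs'} → Step (next b none) R bs R' bs' →
    Step none (row a f z R) (b ∷ bs) (row a f (z + bit b) R') (false ∷ bs')
  room : ∀ {k p a f z b} {R R' : Rows k} {bs bs'} → Step (next b none) R bs R' bs' →
    Step (some p) (row a f (suc z) R) (b ∷ bs) (row (bit p + a) f (z + bit b) R') (true ∷ bs')
  -- The failed insertion keeps v in the last column of the group and bumps it too. If the next row
  -- already has v, the copy fails there, in a column whose length now places it in the present
  -- group; so the new miss flag is b.
  full-miss : ∀ {k p a b} {R R' : Rows k} {bs bs'} → Step (next b (some true)) R bs R' bs' →
    Step (some p) (row a true 0 R) (b ∷ bs) (row (bit p + a) b 0 R') (true ∷ bs')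
  full-push : ∀ {k a b} {R R' : Rows k} {bs bs'} → Step (next b (some true)) R bs R' bs' →
    Step (some true) (row a false 0 R) (b ∷ bs) (row a b 0 R') (false ∷ bs')
  -- The first column, lengthened by v, leaves the group; of its `suc a` insertions the last one is
  -- bumped into the next group.
  full-own : ∀ {k a b} {R R' : Rows k} {bs bs'} → Step (next b (some true)) R bs R' bs' →
    Step (some false) (row (suc a) false 0 R) (b ∷ bs) (row a b 0 R') (false ∷ bs')

-- Scanning groups of columns of equal length

scan-stay : ∀ {g l ls V D V' D'} a → Scan nothing ls V D V' D' →
  Scan nothing (replicate a l ++ ls) (replicate a false ++ V) (replicate a (just g) ++ D)
    (replicate a false ++ V') (replicate a (just g) ++ D')
scan-stay zero sc = sc
scan-stay (suc a) sc = stay (scan-stay a sc)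

scan-idle : ∀ {l ls V D V' D'} z → Scan nothing ls V D V' D' →
  Scan nothing (replicate z l ++ ls) (replicate z false ++ V) (replicate z nothing ++ D)
    (replicate z false ++ V') (replicate z nothing ++ D')
scan-idle zero sc = sc
scan-idle (suc z) sc = idle (scan-idle z sc)

replicate-++ : ∀ {A : Set} {x : A} {ys} m {n} → replicate (m + n) x ++ ys ≡ replicate m x ++ (replicate n x ++ ys)
replicate-++ zero = refl
replicate-++ (suc m) = cong (_ ∷_) (replicate-++ m)

first-false : ∀ g → first false g ≡ replicate g false
first-false zero = refl
first-false (suc g) = refl

-- A neighbour of the same length always accepts v, because the column that v leaves has kept its
-- box: the inserted letter took it over.
push-hit : ∀ {a n n' l ls V D V' D'} → n ≡ suc n' →
  Scan (just true) (replicate n l ++ ls) (first true n ++ V) D V' D' →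
  Scan a (replicate (suc n) l ++ ls) (first true (suc n) ++ V) (just true ∷ D) (false ∷ V') (a ∷ D')
push-hit {l = l} refl sc = move {legal = true} (sym (<ᵇ-true {l} ≤-refl)) sc

-- The letter v rests in the first column that receives no box. If an insertion fails there, the
-- bumped copy of v fails again in the neighbour of equal length, so the miss shifts right and uses
-- up an untouched column.
scan-room : ∀ {l ls V D V' D'} c a f z → Scan nothing ls V D V' D' →
  Scan c (replicate (a + (bit f + suc z)) l ++ ls) (first true (a + (bit f + suc z)) ++ V)
    (replicate a (just true) ++ (replicate (bit f) (just false) ++ (replicate (suc z) nothing ++ D)))
    (replicate a false ++ (first true (bit f + suc z) ++ V'))
    (c ∷ (replicate a (just true) ++ (replicate (bit f) (just false) ++ (replicate z nothing ++ D'))))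
scan-room c (suc a) f z sc = push-hit (trans (cong (a +_) (+-suc (bit f) z)) (+-suc a _)) (scan-room (just true) a f z sc)
scan-room c zero false z sc = idle (scan-idle z sc)
scan-room {l} c zero true z sc = move {legal = false} (sym (<ᵇ-false {l} ≤-refl)) (idle (scan-idle z sc))

scan-full-miss : ∀ {l l₂ ls w V D V' D'} c a → l₂ < l → Scan (just (not w)) (l₂ ∷ ls) (true ∷ V) D V' D' →
  Scan c (replicate (a + 1) l ++ l₂ ∷ ls) (first true (a + 1) ++ w ∷ V)
    (replicate a (just true) ++ (just false ∷ D)) (replicate a false ++ (true ∷ V'))
    (c ∷ (replicate a (just true) ++ D'))
scan-full-miss c (suc a) lt sc = push-hit (+-suc a 0) (scan-full-miss (just true) a lt sc)
scan-full-miss {w = false} c zero lt sc = move {legal = true} (sym (<ᵇ-true lt)) sc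
scan-full-miss {w = true} c zero lt sc = move {legal = true} (sym (<ᵇ-true lt)) sc

scan-full : ∀ {l l₂ ls w V D V' D'} c a → l₂ < l → Scan (just (not w)) (l₂ ∷ ls) (true ∷ V) D V' D' →
  Scan c (replicate (suc a + 0) l ++ l₂ ∷ ls) (first true (suc a + 0) ++ w ∷ V)
    (just true ∷ (replicate a (just true) ++ D)) (false ∷ (replicate a false ++ V'))
    (c ∷ (replicate a (just true) ++ D'))
scan-full c (suc a) lt sc = push-hit {n' = a + 0} refl (scan-full (just true) a lt sc)
scan-full {w = false} c zero lt sc = move {legal = true} (sym (<ᵇ-true (m<n⇒m<1+n lt))) sc
scan-full {w = true} c zero lt sc = move {legal = true} (sym (<ᵇ-true (m<n⇒m<1+n lt))) sc

arrive : Bool → Label → List Label → List Label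
arrive pushed c D = if pushed then D else c ∷ D

-- If v was pushed into the rows R then the label c is absorbed by R'; otherwise
-- it belongs to the row below.
record Moving {k} (p : Bool) (R : Rows k) (bs : Vec Bool k) (R' : Rows k) (bs' : Vec Bool (suc k)) : Set where
  constructor moving
  field
    {l} : ℕ
    {ls} : List ℕ
    {w} : Bool
    {V} : List Bool
    heights≡ : heights (gaps R) ≡ l ∷ ls
    l≤ : l ≤ k
    own : p ≡ false → w ≡ true
    corners≡ : corners (gaps R) (not p ∷ bs) ≡ w ∷ V
    scan : ∀ c → (p ≡ true → c ≡ just (not w)) →
      Scan c (l ∷ ls) (true ∷ V) (labels R) (corners′ R bs') (arrive p c (labels R'))

moving-run : ∀ {k p n n' bs bs' ls V Y} {R R' : Rows k} → n ≡ suc n' →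
  heights (gaps R) ≡ replicate n k ++ ls → (∀ b → corners (gaps R) (b ∷ bs) ≡ first b n ++ V) →
  labels R' ≡ replicate (bit p) (just true) ++ Y →
  (∀ c → Scan c (replicate n k ++ ls) (first true n ++ V) (labels R) (corners′ R bs') (c ∷ Y)) →
  Moving p R bs R' bs'
moving-run {p = true} refl h≡ c≡ l≡ sc = moving h≡ ≤-refl (λ ()) (c≡ false)
  λ c e → subst₂ (λ c → Scan c _ _ _ _) (sym (e refl)) (sym l≡) (sc (just true))
moving-run {p = false} refl h≡ c≡ l≡ sc = moving h≡ ≤-refl (λ _ → refl) (c≡ true)
  λ c _ → subst (λ D → Scan c _ _ _ _ (c ∷ D)) (sym l≡) (sc c)

Resting : ∀ {k} → Rows k → Vec Bool k → Rows k → Vec Bool (suc k) → Set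
Resting R bs R' bs' =
  Scan nothing (heights (gaps R)) (corners (gaps R) (false ∷ bs)) (labels R) (corners′ R bs') (labels R')

Scanned : ∀ {k} → Origin → Rows k → Vec Bool k → Rows k → Vec Bool (suc k) → Set
Scanned none = Resting
Scanned (some p) = Moving p

-- A v of this row sits in the first column of its group; lengthened, that column counts as an
-- untouched one of the group before.
from-none : ∀ {k} b {R R' : Rows k} {bs bs'} → Scanned (next b none) R bs R' bs' →
  Scan nothing (heights (gaps R)) (corners (gaps R) (b ∷ bs)) (labels R) (corners′ R bs')
    (replicate (bit b) nothing ++ labels R')
from-none false sc = sc
from-none true (moving h≡ _ own c≡ sc) rewrite h≡ | c≡ | own refl = sc nothing λ ()

record Pushing {k} b (R : Rows k) (bs : Vec Bool k) (R' : Rows k) (bs' : Vec Bool (suc k)) : Set where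
  constructor pushing
  field
    {l} : ℕ
    {ls} : List ℕ
    {w} : Bool
    {V} : List Bool
    heights≡ : heights (gaps R) ≡ l ∷ ls
    l≤ : l ≤ k
    corners≡ : corners (gaps R) (b ∷ bs) ≡ w ∷ V
    scan : Scan (just (not w)) (l ∷ ls) (true ∷ V) (labels R) (corners′ R bs')
      (replicate (bit b) (just false) ++ labels R')

-- As in `from-none`, but now a second v is pushed onto the column that has one, so that column is
-- labelled by a failure.
from-push : ∀ {k} b {R R' : Rows k} {bs bs'} → Scanned (next b (some true)) R bs R' bs' → Pushing b R bs R' bs'
from-push false (moving h≡ l≤ own c≡ sc) = pushing h≡ l≤ c≡ (sc _ λ _ → refl)
from-push true (moving h≡ l≤ own c≡ sc) rewrite own refl = pushing h≡ l≤ c≡ (sc _ λ ())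

resting-run : ∀ {l ls V D V' D'} a f z → Scan nothing ls V D V' D' →
  Scan nothing (replicate (a + (bit f + z)) l ++ ls) (first false (a + (bit f + z)) ++ V)
    (replicate a (just true) ++ (replicate (bit f) (just false) ++ (replicate z nothing ++ D)))
    (replicate a false ++ (first false (bit f + z) ++ V'))
    (replicate a (just true) ++ (replicate (bit f) (just false) ++ (replicate z nothing ++ D')))
resting-run {l} {ls} {V} {V' = V'} a f z sc
  rewrite first-false (a + (bit f + z)) | first-false (bit f + z)
        | replicate-++ {x = l} {ls} a {bit f + z} | replicate-++ {x = l} {ls} (bit f) {z}
        | replicate-++ {x = false} {V} a {bit f + z} | replicate-++ {x = false} {V} (bit f) {z}
        | replicate-++ {x = false} {V'} (bit f) {z}
  = scan-stay a (scan-stay (bit f) (scan-idle z sc))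

step-scan : ∀ {k o bs bs'} {R R' : Rows k} → Step o R bs R' bs' → Scanned o R bs R' bs'
step-scan (top-none {a} {z}) = resting-run a false z []
step-scan (top-some {p} {a} {z}) = moving-run (+-suc a z) refl (λ _ → refl) (replicate-++ (bit p)) λ c → scan-room c a false z []
step-scan (absent {a = a} {f} {z} {b} {R' = R'} st)
  rewrite replicate-++ {x = nothing {A = Bool}} {labels R'} z {bit b} =
  resting-run a f z (from-none b (step-scan st))
step-scan (room {p = p} {a} {f} {z} {b} {R' = R'} st) =
  moving-run (trans (cong (a +_) (+-suc (bit f) z)) (+-suc a _)) refl (λ _ → refl) (replicate-++ (bit p))
    λ c → subst (λ X → Scan c _ _ _ _ (c ∷ (replicate a (just true) ++ (replicate (bit f) (just false) ++ X))))
      (sym (replicate-++ z)) (scan-room c a f z (from-none b (step-scan st)))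
step-scan (full-miss {p = p} {a} {b} st) with from-push b (step-scan st)
... | pushing h≡ l≤ c≡ sc =
  moving-run (+-suc a 0) (cong (replicate (a + 1) _ ++_) h≡) (λ _ → cong (first _ (a + 1) ++_) c≡) (replicate-++ (bit p))
    λ c → scan-full-miss c a (s≤s l≤) sc
step-scan (full-own {a = a} {b} st) with from-push b (step-scan st)
... | pushing h≡ l≤ c≡ sc =
  moving-run {n = suc a + 0} refl (cong (replicate (suc a + 0) _ ++_) h≡) (λ _ → cong (first _ (suc a + 0) ++_) c≡) refl
    λ c → scan-full c a (s≤s l≤) sc
step-scan (full-push {a = suc a} {b} st) with from-push b (step-scan st)
... | pushing h≡ l≤ c≡ sc =
  moving-run {n = suc a + 0} refl (cong (replicate (suc a + 0) _ ++_) h≡) (λ _ → cong (first _ (suc a + 0) ++_) c≡) refl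
    λ c → scan-full c a (s≤s l≤) sc
-- The group is empty, so v passes straight on to a group of shorter columns; this is why `l≤` is
-- only an inequality.
step-scan (full-push {a = zero} {b} st) with from-push b (step-scan st)
... | pushing h≡ l≤ c≡ sc = moving h≡ (m≤n⇒m≤1+n l≤) (λ ()) c≡ λ { c e → subst (λ c → Scan c _ _ _ _ _) (sym (e refl)) sc }

-- Group sizes before and after an insertion

headBit : ∀ {k} → Vec Bool k → Bool
headBit [] = false
headBit (b ∷ _) = b

-- Adding a box in the rows bs moves a column from the group of length r to the
-- group of length r + 1, for each such row r.
data Upd : ∀ {k} → Vec ℕ k → Vec Bool k → Vec ℕ k → Set where
  [] : Upd [] [] []
  cons : ∀ {k g g' b h} {gs gs' : Vec ℕ k} {bs} → g ≡ bit b + h → g' ≡ h + bit (headBit bs) →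
         Upd gs bs gs' → Upd (g ∷ gs) (b ∷ bs) (g' ∷ gs')

Upd-unique : ∀ {k} {gs gs₁ gs₂ : Vec ℕ k} {bs} → Upd gs bs gs₁ → Upd gs bs gs₂ → gs₁ ≡ gs₂
Upd-unique [] [] = refl
Upd-unique (cons {b = b} refl refl u) (cons eq refl u')
  with refl ← +-cancelˡ-≡ (bit b) _ _ eq = cong (_ ∷_) (Upd-unique u u')

isOwn : Origin → Bool
isOwn none = false
isOwn (some p) = not p

isOwn-next-none : ∀ b → isOwn (next b none) ≡ b
isOwn-next-none false = refl
isOwn-next-none true = refl

isOwn-next-push : ∀ b → isOwn (next b (some true)) ≡ b
isOwn-next-push false = refl
isOwn-next-push true = refl

step-gaps : ∀ {k o bs bs'} {R R' : Rows k} → Step o R bs R' bs' → Upd (gaps R) (isOwn o ∷ bs) (gaps R')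
step-gaps (top-none {a} {z}) = cons refl (sym (+-identityʳ (a + z))) []
step-gaps (top-some {false} {a} {z}) = cons (+-suc a z) (sym (+-identityʳ (a + z))) []
step-gaps (top-some {true} {a} {z}) = cons {h = a + suc z} refl (lem a z) []
  where lem : ∀ a z → suc a + z ≡ a + suc z + 0
        lem = solve-∀
step-gaps (absent {a = a} {f} {z} {b} {bs = bs} st) =
  cons refl (lem a (bit f) z (bit b)) (subst (λ b → Upd _ (b ∷ bs) _) (isOwn-next-none b) (step-gaps st))
  where lem : ∀ a f z b → a + (f + (z + b)) ≡ a + (f + z) + b
        lem = solve-∀
step-gaps (room {p = p} {a = a} {f} {z} {b} {bs = bs} st) =
  cons (lem₁ p) (lem₂ a (bit f) z (bit b) (bit p)) (subst (λ b → Upd _ (b ∷ bs) _) (isOwn-next-none b) (step-gaps st))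
  where lem₁ : ∀ p → a + (bit f + suc z) ≡ bit (not p) + (bit p + (a + (bit f + z)))
        lem₁ false = trans (cong (a +_) (+-suc (bit f) z)) (+-suc a _)
        lem₁ true = trans (cong (a +_) (+-suc (bit f) z)) (+-suc a _)
        lem₂ : ∀ a f z b p → p + a + (f + (z + b)) ≡ p + (a + (f + z)) + b
        lem₂ = solve-∀
step-gaps (full-miss {p = p} {a = a} {b} {bs = bs} st) =
  cons (lem₁ p) (lem₂ a (bit b) (bit p)) (subst (λ b → Upd _ (b ∷ bs) _) (isOwn-next-push b) (step-gaps st))
  where lem₁ : ∀ p → a + 1 ≡ bit (not p) + (bit p + a)
        lem₁ false = +-comm a 1
        lem₁ true = +-comm a 1
        lem₂ : ∀ a b p → p + a + (b + 0) ≡ p + a + b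
        lem₂ = solve-∀
step-gaps (full-push {a = a} {b} {bs = bs} st) =
  cons refl (lem₂ a (bit b)) (subst (λ b → Upd _ (b ∷ bs) _) (isOwn-next-push b) (step-gaps st))
  where lem₂ : ∀ a b → a + (b + 0) ≡ a + 0 + b
        lem₂ = solve-∀
step-gaps (full-own {a = a} {b} {bs = bs} st) =
  cons refl (lem₂ a (bit b)) (subst (λ b → Upd _ (b ∷ bs) _) (isOwn-next-push b) (step-gaps st))
  where lem₂ : ∀ a b → a + (b + 0) ≡ a + 0 + b
        lem₂ = solve-∀

lead : ∀ {k} → Rows k → ℕ
lead (top a z) = a
lead (row a f z R) = a

rest : ∀ {k} → Rows k → Vec ℕ (suc k)
rest (top a z) = z ∷ []
rest (row a f z R) = (bit f + z + lead R) ∷ rest R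

-- The group sizes of the tableau after the insertion, now with one more row.
gaps′ : ∀ {k} → Rows k → Vec ℕ (suc (suc k))
gaps′ R = lead R ∷ rest R

step-lead : ∀ {k o bs bs'} {R R' : Rows k} → Step o R bs R' bs' → lead R' + bit (isOwn o) ≡ lead R + bit (headBit bs')
step-lead top-none = refl
step-lead (top-some {false}) = refl
step-lead (top-some {true} {a}) = lem a
  where lem : ∀ a → suc a + 0 ≡ a + 1
        lem = solve-∀
step-lead (absent st) = refl
step-lead (room {p = false} st) = refl
step-lead (room {p = true} {a} st) = lem a
  where lem : ∀ a → suc a + 0 ≡ a + 1
        lem = solve-∀
step-lead (full-miss {p = false} st) = refl
step-lead (full-miss {p = true} {a} st) = lem a
  where lem : ∀ a → suc a + 0 ≡ a + 1
        lem = solve-∀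
step-lead (full-push st) = refl
step-lead (full-own {a = a} st) = lem a
  where lem : ∀ a → a + 1 ≡ suc a + 0
        lem = solve-∀

lead-next-none : ∀ {k b bs bs'} {R R' : Rows k} → Step (next b none) R bs R' bs' → lead R + bit (headBit bs') ≡ lead R' + bit b
lead-next-none {b = b} {R' = R'} st = sym (trans (cong (λ b → lead R' + bit b) (sym (isOwn-next-none b))) (step-lead st))

lead-next-push : ∀ {k b bs bs'} {R R' : Rows k} → Step (next b (some true)) R bs R' bs' → lead R + bit (headBit bs') ≡ lead R' + bit b
lead-next-push {b = b} {R' = R'} st = sym (trans (cong (λ b → lead R' + bit b) (sym (isOwn-next-push b))) (step-lead st))

step-rest : ∀ {k o bs bs'} {R R' : Rows k} → Step o R bs R' bs' → Upd (rest R) bs' (rest R')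
step-rest (top-none {z = z}) = cons refl (sym (+-identityʳ z)) []
step-rest (top-some {z = z}) = cons refl (sym (+-identityʳ z)) []
step-rest (absent {f = f} {z} {b} {R} {R'} {bs' = bs'} st) = cons {h = bit f + z + lead R} refl (sym
  (trans (+-assoc (bit f + z) (lead R) _) (trans (cong (bit f + z +_) (lead-next-none st)) (lem (bit f) z (lead R') (bit b))))) (step-rest st)
  where lem : ∀ f z l b → f + z + (l + b) ≡ f + (z + b) + l
        lem = solve-∀
step-rest (room {f = f} {z} {b} {R} {R'} {bs' = bs'} st) = cons {h = bit f + z + lead R} (cong (_+ lead R) (+-suc (bit f) z)) (sym
  (trans (+-assoc (bit f + z) (lead R) _) (trans (cong (bit f + z +_) (lead-next-none st)) (lem (bit f) z (lead R') (bit b))))) (step-rest st)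
  where lem : ∀ f z l b → f + z + (l + b) ≡ f + (z + b) + l
        lem = solve-∀
step-rest (full-miss {b = b} {R} {R'} st) = cons {h = lead R} refl (sym (trans (lead-next-push st) (lem (lead R') (bit b)))) (step-rest st)
  where lem : ∀ l b → l + b ≡ b + 0 + l
        lem = solve-∀
step-rest (full-push {b = b} {R} {R'} st) = cons {h = lead R} refl (sym (trans (lead-next-push st) (lem (lead R') (bit b)))) (step-rest st)
  where lem : ∀ l b → l + b ≡ b + 0 + l
        lem = solve-∀
step-rest (full-own {b = b} {R} {R'} st) = cons {h = lead R} refl (sym (trans (lead-next-push st) (lem (lead R') (bit b)))) (step-rest st)
  where lem : ∀ l b → l + b ≡ b + 0 + l
        lem = solve-∀

step-gaps′ : ∀ {k o bs bs'} {R R' : Rows k} → isOwn o ≡ false → Step o R bs R' bs' →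
  Upd (gaps′ R) (false ∷ bs') (gaps′ R')
step-gaps′ {R' = R'} o≡ st = cons refl
  (trans (sym (+-identityʳ (lead R'))) (trans (cong (λ b → lead R' + bit b) (sym o≡)) (step-lead st))) (step-rest st)

first-false-prefix : ∀ g {V} → first false g ++ V ≡ replicate g false ++ V
first-false-prefix g {V} = cong (_++ V) (first-false g)

first-++ : ∀ b n m {V} → first b (suc n + m) ++ V ≡ first b (suc n) ++ (replicate m false ++ V)
first-++ b n m = cong (b ∷_) (replicate-++ n)

first-false-++ : ∀ n m {V} → first false (n + m) ++ V ≡ first false n ++ (replicate m false ++ V)
first-false-++ n m {V} rewrite first-false (n + m) | first-false n = replicate-++ n

corners′-rest : ∀ {k o bs bs'} {R R' : Rows k} → Step o R bs R' bs' →
  replicate (lead R) false ++ corners (rest R) bs' ≡ corners′ R bs'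
corners′-rest top-none = refl
corners′-rest top-some = refl
corners′-rest (absent {a = a} {f} {z} {R = R} st) = cong (replicate a false ++_)
  (trans (first-false-++ (bit f + z) (lead R)) (cong (first false (bit f + z) ++_) (corners′-rest st)))
corners′-rest (room {a = a} {f} {z} {R = R} st) rewrite +-suc (bit f) z = cong (replicate a false ++_)
  (trans (first-++ true (bit f + z) (lead R)) (cong (first true (suc (bit f + z)) ++_) (corners′-rest st)))
corners′-rest (full-miss {a = a} {R = R} st) = cong (replicate a false ++_) (cong (true ∷_) (corners′-rest st))
corners′-rest (full-push {a = a} {R = R} st) = cong (replicate a false ++_)
  (trans (first-false-prefix (lead R)) (corners′-rest st))
corners′-rest (full-own {a = a} {R = R} st) = cong (replicate (suc a) false ++_)
  (trans (first-false-prefix (lead R)) (corners′-rest st))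

corners-gaps′ : ∀ {k o bs bs'} {R R' : Rows k} → Step o R bs R' bs' →
  corners (gaps′ R) (false ∷ bs') ≡ corners′ R bs'
corners-gaps′ {R = R} st = trans (first-false-prefix (lead R)) (corners′-rest st)

free : ∀ {k} → Rows k → ℕ
free (top a z) = z
free (row a f z R) = free R

-- A v that reaches the top row needs an empty column, which `1 ≤ free R` provides. The hypothesis
-- `Upd` ensures that the group in which v has its own column is not empty. Each letter takes at
-- most one empty column, so as many columns as letters suffice.
step-exists : ∀ {k} o (R : Rows k) bs {gs'} → 1 ≤ free R → Upd (gaps R) (isOwn o ∷ bs) gs' →
  ∃[ R' ] ∃[ bs' ] Step o R bs R' bs' × free R ≤ suc (free R')
step-exists none (top a z) [] z≥1 u = _ , _ , top-none , n≤1+n z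
step-exists (some p) (top a (suc z)) [] z≥1 u = _ , _ , top-some , ≤-refl
step-exists none (row a f z R) (b ∷ bs) z≥1 (cons _ _ u)
  with _ , _ , st , le ← step-exists (next b none) R bs z≥1 (subst (λ b → Upd _ (b ∷ bs) _) (sym (isOwn-next-none b)) u) =
  _ , _ , absent st , le
step-exists (some p) (row a f (suc z) R) (b ∷ bs) z≥1 (cons _ _ u)
  with _ , _ , st , le ← step-exists (next b none) R bs z≥1 (subst (λ b → Upd _ (b ∷ bs) _) (sym (isOwn-next-none b)) u) =
  _ , _ , room st , le
step-exists (some p) (row a true zero R) (b ∷ bs) z≥1 (cons _ _ u)
  with _ , _ , st , le ← step-exists (next b (some true)) R bs z≥1 (subst (λ b → Upd _ (b ∷ bs) _) (sym (isOwn-next-push b)) u) =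
  _ , _ , full-miss st , le
step-exists (some true) (row a false zero R) (b ∷ bs) z≥1 (cons _ _ u)
  with _ , _ , st , le ← step-exists (next b (some true)) R bs z≥1 (subst (λ b → Upd _ (b ∷ bs) _) (sym (isOwn-next-push b)) u) =
  _ , _ , full-push st , le
step-exists (some false) (row (suc a) false zero R) (b ∷ bs) z≥1 (cons _ _ u)
  with _ , _ , st , le ← step-exists (next b (some true)) R bs z≥1 (subst (λ b → Upd _ (b ∷ bs) _) (sym (isOwn-next-push b)) u) =
  _ , _ , full-own st , le
step-exists (some false) (row zero false zero R) (b ∷ bs) z≥1 (cons () _ u)

-- Tableaux built from the subsets, letter by letter

rowBits : ∀ {n} → Subset n → (k : ℕ) → Vec Bool k
rowBits b zero = []
rowBits b (suc k) = mem b (suc k) ∷ rowBits b k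

noBoxes : (N k : ℕ) → Vec ℕ (suc k)
noBoxes N zero = N ∷ []
noBoxes N (suc k) = 0 ∷ noBoxes N k

-- T, with N columns, is the tableau of the rows 1, …, k of S, and gs lists the
-- numbers of its columns of length k, …, 0.
data Rep {n} (k N : ℕ) : ∀ {m} → Vec ℕ (suc k) → SVW n m → Cols → Set where
  [] : Rep k N (noBoxes N k) [] (replicate N [])
  _∷_ : ∀ {m gs gs' b T} {c : SVW n m} → Rep k N gs c T → Upd gs (false ∷ rowBits b k) gs' →
        Rep k N gs' (b ∷ c) (addLetter (suc m) (corners gs (false ∷ rowBits b k)) T)

addLengths : List ℕ → List Bool → List ℕ
addLengths (l ∷ ls) (b ∷ bs) = (if b then suc l else l) ∷ addLengths ls bs
addLengths ls _ = ls

map-length-addLetter : ∀ v V T → map length (addLetter v V T) ≡ addLengths (map length T) V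
map-length-addLetter v [] [] = refl
map-length-addLetter v [] (c ∷ T) = refl
map-length-addLetter v (b ∷ V) [] = refl
map-length-addLetter v (false ∷ V) (c ∷ T) = cong (_ ∷_) (map-length-addLetter v V T)
map-length-addLetter v (true ∷ V) (c ∷ T) = cong₂ _∷_ (length-snoc c v) (map-length-addLetter v V T)

addLengths-false : ∀ n {l ls V} → addLengths (replicate n l ++ ls) (replicate n false ++ V) ≡ replicate n l ++ addLengths ls V
addLengths-false zero = refl
addLengths-false (suc n) = cong (_ ∷_) (addLengths-false n)

addLengths-corners : ∀ {k} {gs gs' : Vec ℕ k} {bs} → Upd gs bs gs' →
  addLengths (heights gs) (corners gs bs) ≡ replicate (bit (headBit bs)) k ++ heights gs'
addLengths-corners [] = refl
addLengths-corners {suc k} (cons {b = false} {h} {bs = bs} refl refl u)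
  rewrite first-false h = trans (addLengths-false h)
    (trans (cong (replicate h k ++_) (addLengths-corners u)) (sym (replicate-++ h)))
addLengths-corners {suc k} (cons {b = true} {h} {bs = bs} refl refl u) = cong (suc k ∷_) (trans (addLengths-false h)
    (trans (cong (replicate h k ++_) (addLengths-corners u)) (sym (replicate-++ h))))

addLetter-heights : ∀ {k} {gs gs' : Vec ℕ k} {bs} v T → Upd gs bs gs' → map length T ≡ heights gs →
  map length (addLetter v (corners gs bs) T) ≡ replicate (bit (headBit bs)) k ++ heights gs'
addLetter-heights {gs = gs} {bs = bs} v T u h = trans (map-length-addLetter v (corners gs bs) T)
  (trans (cong (λ ls → addLengths ls (corners gs bs)) h) (addLengths-corners u))

heights-noBoxes : ∀ N k → heights (noBoxes N k) ≡ replicate N 0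
heights-noBoxes zero zero = refl
heights-noBoxes (suc N) zero = cong (0 ∷_) (heights-noBoxes N zero)
heights-noBoxes N (suc k) = heights-noBoxes N k

map-length-replicate : ∀ N → map length (replicate N ([] {A = ℕ})) ≡ replicate N 0
map-length-replicate zero = refl
map-length-replicate (suc N) = cong (0 ∷_) (map-length-replicate N)

rep-heights : ∀ {n k N m gs T} {S : SVW n m} → Rep k N gs S T → map length T ≡ heights gs
rep-heights {k = k} {N} [] = trans (map-length-replicate N) (sym (heights-noBoxes N k))
rep-heights (_∷_ {m} {T = T} r u) = addLetter-heights (suc m) T u (rep-heights r)

addLetter-Below : ∀ {v T} V → All (Below v) T → All (Below (suc v)) (addLetter v V T)
addLetter-Below [] [] = []
addLetter-Below (b ∷ V) [] = []
addLetter-Below [] ((s , a) ∷ cvs) = (s , All.map m<n⇒m<1+n a) ∷ addLetter-Below [] cvs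
addLetter-Below (false ∷ V) ((s , a) ∷ cvs) = (s , All.map m<n⇒m<1+n a) ∷ addLetter-Below V cvs
addLetter-Below (true ∷ V) (_∷_ {c} (s , a) cvs) =
  (trans (strictInc-snoc c a) s , ++⁺ (All.map m<n⇒m<1+n a) (≤-refl ∷ [])) ∷ addLetter-Below V cvs

rep-Below : ∀ {n k N m gs T} {S : SVW n m} → Rep k N gs S T → All (Below (suc m)) T
rep-Below {N = N} [] = replicate⁺ N (refl , [])
rep-Below (r ∷ u) = addLetter-Below _ (rep-Below r)

-- The operators E of a tensor product

-- k applications of op lead from x to z, where op is undefined.
data Exhausts {A : Set} (op : A → Maybe A) : A → ℕ → A → Set where
  done : ∀ {x} → op x ≡ nothing → Exhausts op x 0 x
  step : ∀ {x y k z} → op x ≡ just y → Exhausts op y k z → Exhausts op x (suc k) z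

data Iterates {A : Set} (op : A → Maybe A) : ℕ → A → A → Set where
  done : ∀ {x} → Iterates op 0 x x
  step : ∀ {x y k z} → op x ≡ just y → Iterates op k y z → Iterates op (suc k) x z

exhausts-count : ∀ {A : Set} {op : A → Maybe A} {x k z fuel} → Exhausts op x k z → k ≤ fuel → count fuel op x ≡ k
exhausts-count {fuel = zero} (done eq) z≤n = refl
exhausts-count {fuel = suc fuel} (done eq) z≤n rewrite eq = refl
exhausts-count (step eq s) (s≤s le) rewrite eq = cong suc (exhausts-count s le)

exhausts-iterM : ∀ {A : Set} {op : A → Maybe A} {x k z} → Exhausts op x k z → iterM k op x ≡ just z
exhausts-iterM (done eq) = refl
exhausts-iterM (step eq s) rewrite eq = exhausts-iterM s

memV-setV : ∀ {n} (T : Subset n) j x → j < n → memV (setV T j x) j ≡ x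
memV-setV (_ ∷ T) zero x _ = refl
memV-setV (_ ∷ T) (suc j) x (s≤s lt) = memV-setV T j x lt

memV-setV-≢ : ∀ {n} (T : Subset n) j x l → l ≢ j → memV (setV T j x) l ≡ memV T l
memV-setV-≢ [] j x l ne = refl
memV-setV-≢ (_ ∷ T) zero x zero ne = contradiction refl ne
memV-setV-≢ (_ ∷ T) zero x (suc l) ne = refl
memV-setV-≢ (_ ∷ T) (suc j) x zero ne = refl
memV-setV-≢ (_ ∷ T) (suc j) x (suc l) ne = memV-setV-≢ T j x l λ e → ne (cong suc e)

setV-undo : ∀ {n} (T : Subset n) j x y → memV T j ≡ y → setV (setV T j x) j y ≡ T
setV-undo [] j x y eq = refl
setV-undo (_ ∷ T) zero x y refl = refl
setV-undo (_ ∷ T) (suc j) x y eq = cong (_ ∷_) (setV-undo T j x y eq)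

-- The crystal structure on one subset T in terms of the bits i ∈ T, i+1 ∈ T.
εbits φbits : Bool → Bool → ℕ
εbits _ false = 0
εbits false true = 2
εbits true true = 1
φbits false _ = 0
φbits true false = 2
φbits true true = 1

after : ℕ → Bool → Bool → Bool × Bool
after zero p q = p , q
after (suc d) p false = p , false
after (suc d) false true = after d true true
after (suc d) true true = after d true false

module Pair {n} (j : ℕ) (j+1<n : suc j < n) where

  j<n : j < n
  j<n = <-trans ≤-refl j+1<n

  e f : Subset n → Maybe (Subset n)
  e = eSub (suc j)
  f = fSub (suc j)

  data Bits (T : Subset n) : Bool → Bool → Set where
    bits : ∀ {p q} → memV T j ≡ p → memV T (suc j) ≡ q → Bits T p q

  bits-of : ∀ T → Bits T (memV T j) (memV T (suc j))
  bits-of T = bits refl refl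

  set-lower : ∀ {T p q} x → Bits T p q → Bits (setV T j x) x q
  set-lower {T} x (bits _ q) = bits (memV-setV T j x j<n) (trans (memV-setV-≢ T j x (suc j) 1+n≢n) q)

  set-upper : ∀ {T p q} x → Bits T p q → Bits (setV T (suc j) x) p x
  set-upper {T} x (bits p _) = bits (trans (memV-setV-≢ T (suc j) x j λ e → 1+n≢n (sym e)) p) (memV-setV T (suc j) x j+1<n)

  e-ft : ∀ {T} → Bits T false true → e T ≡ just (setV T j true)
  e-ft (bits p q) rewrite p | q = refl
  e-tt : ∀ {T} → Bits T true true → e T ≡ just (setV T (suc j) false)
  e-tt (bits p q) rewrite p | q = refl
  e-f : ∀ {T p} → Bits T p false → e T ≡ nothing
  e-f {p = false} (bits p q) rewrite p | q = refl
  e-f {p = true} (bits p q) rewrite p | q = refl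
  f-tf : ∀ {T} → Bits T true false → f T ≡ just (setV T (suc j) true)
  f-tf (bits p q) rewrite p | q = refl
  f-tt : ∀ {T} → Bits T true true → f T ≡ just (setV T j false)
  f-tt (bits p q) rewrite p | q = refl
  f-f : ∀ {T q} → Bits T false q → f T ≡ nothing
  f-f (bits p q) rewrite p = refl

  e-str : ∀ {T p q} → Bits T p q → ∃[ z ] Exhausts e T (εbits p q) z
  e-str {q = false} B = _ , done (e-f B)
  e-str {p = true} {true} B = _ , step (e-tt B) (done (e-f (set-upper false B)))
  e-str {p = false} {true} B with _ , s ← e-str (set-lower true B) = _ , step (e-ft B) s

  f-str : ∀ {T p q} → Bits T p q → ∃[ z ] Exhausts f T (φbits p q) z
  f-str {p = false} B = _ , done (f-f B)
  f-str {p = true} {true} B = _ , step (f-tt B) (done (f-f (set-lower false B)))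
  f-str {p = true} {false} B with _ , s ← f-str (set-upper true B) = _ , step (f-tf B) s

  e⇒f : ∀ {T T'} → e T ≡ just T' → f T' ≡ just T
  e⇒f {T} = go (bits-of T)
    where
    go : ∀ {p q T'} → Bits T p q → e T ≡ just T' → f T' ≡ just T
    go {q = false} B eq with () ← trans (sym (e-f B)) eq
    go {true} {true} B@(bits _ q) eq with refl ← trans (sym (e-tt B)) eq =
      trans (f-tf (set-upper false B)) (cong just (setV-undo T (suc j) false true q))
    go {false} {true} B@(bits p _) eq with refl ← trans (sym (e-ft B)) eq =
      trans (f-tt (set-lower true B)) (cong just (setV-undo T j true false p))

  f⇒e : ∀ {T T'} → f T ≡ just T' → e T' ≡ just T
  f⇒e {T} = go (bits-of T)
    where
    go : ∀ {p q T'} → Bits T p q → f T ≡ just T' → e T' ≡ just T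
    go {false} B eq with () ← trans (sym (f-f B)) eq
    go {true} {true} B@(bits p _) eq with refl ← trans (sym (f-tt B)) eq =
      trans (e-ft (set-lower false B)) (cong just (setV-undo T j false true p))
    go {true} {false} B@(bits _ q) eq with refl ← trans (sym (f-tf B)) eq =
      trans (e-tt (set-upper true B)) (cong just (setV-undo T (suc j) true false q))

  e-pow : ∀ {T p q} d → d ≤ εbits p q → Bits T p q → ∃[ T' ] Iterates e d T T' ×
    Bits T' (proj₁ (after d p q)) (proj₂ (after d p q)) × (∀ l → l ≢ j → l ≢ suc j → memV T' l ≡ memV T l)
  e-pow zero _ B = _ , done , B , λ _ _ _ → refl
  e-pow {T} {false} {true} (suc d) (s≤s le) B with T' , s , B' , same ← e-pow d le (set-lower true B) =
    T' , step (e-ft B) s , B' , λ l n₁ n₂ → trans (same l n₁ n₂) (memV-setV-≢ T j true l n₁)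
  e-pow {T} {true} {true} (suc d) (s≤s le) B with T' , s , B' , same ← e-pow d le (set-upper false B) =
    T' , step (e-tt B) s , B' , λ l n₁ n₂ → trans (same l n₁ n₂) (memV-setV-≢ T (suc j) false l n₂)

  εbits+φbits : ∀ p q → εbits p q + φbits p q ≤ 2
  εbits+φbits false false = z≤n
  εbits+φbits false true = ≤-refl
  εbits+φbits true false = ≤-refl
  εbits+φbits true true = ≤-refl

  -- The field `bounded` makes the counting fuel `suc (2 * m)` sufficient; it passes to tensor
  -- products because ε + φ ≤ 2 on a single subset.
  record Strings {m} (c : SVW n m) (ε φ : ℕ) (c' : SVW n m) : Set where
    constructor strings
    field
      {c″} : SVW n m
      e-string : Exhausts (eT (suc j)) c ε c'
      f-string : Exhausts (fT (suc j)) c φ c″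
      bounded : ε + φ ≤ 2 * m

  module _ {m : ℕ} {b : Subset n} {c : SVW n m} {εb φc : ℕ} {b₁ c₁}
           (eb : Exhausts e b εb b₁) (εb≤ : εb ≤ 3) (fc : Exhausts (fT (suc j)) c φc c₁) (φc≤ : φc ≤ suc (2 * m)) where

    e-right : εb ≤ φc → eT (suc j) (b ∷ c) ≡ Maybe.map (b ∷_) (eT (suc j) c)
    e-right le rewrite exhausts-count eb εb≤ | exhausts-count fc φc≤ | ≤ᵇ-true le = refl

    e-left : φc < εb → eT (suc j) (b ∷ c) ≡ Maybe.map (_∷ c) (e b)
    e-left lt rewrite exhausts-count eb εb≤ | exhausts-count fc φc≤ | ≤ᵇ-false lt = refl

    f-right : εb < φc → fT (suc j) (b ∷ c) ≡ Maybe.map (b ∷_) (fT (suc j) c)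
    f-right lt rewrite exhausts-count eb εb≤ | exhausts-count fc φc≤ | <ᵇ-true lt = refl

    f-left : φc ≤ εb → fT (suc j) (b ∷ c) ≡ Maybe.map (_∷ c) (f b)
    f-left le rewrite exhausts-count eb εb≤ | exhausts-count fc φc≤ | <ᵇ-false le = refl

  Inverse : ℕ → Set
  Inverse m = ∀ (c c₁ : SVW n m) → eT (suc j) c ≡ just c₁ → fT (suc j) c₁ ≡ just c

  tensor-e-right : ∀ {m b εb b₁ ε φ} {c c' c″ : SVW n m} → Inverse m → Exhausts e b εb b₁ → εb ≤ 3 → εb ≤ φ →
    Exhausts (eT (suc j)) c ε c' → Exhausts (fT (suc j)) c φ c″ → ε + φ ≤ 2 * m → Exhausts (eT (suc j)) (b ∷ c) ε (b ∷ c')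
  tensor-e-right {b = b} inv eb εb≤ le (done eq) fc bd =
    done (trans (e-right eb εb≤ fc (m≤n⇒m≤1+n bd) le) (cong (Maybe.map (b ∷_)) eq))
  tensor-e-right {m} {b = b} {φ = φ} inv eb εb≤ le (step {k = k} eq s) fc bd =
    step (trans (e-right eb εb≤ fc (m≤n⇒m≤1+n (≤-trans (m≤n+m φ (suc k)) bd)) le) (cong (Maybe.map (b ∷_)) eq))
      (tensor-e-right inv eb εb≤ (m≤n⇒m≤1+n le) s (step (inv _ _ eq) fc) (subst (_≤ 2 * m) (sym (+-suc k φ)) bd))

  tensor-e : ∀ {m b εb b₁ b' d ε φ} {c c' c″ : SVW n m} → Inverse m → Exhausts e b εb b₁ → εb ≤ 3 →
    Iterates e d b b' → d ≡ εb ∸ φ →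
    Exhausts (eT (suc j)) c ε c' → Exhausts (fT (suc j)) c φ c″ → ε + φ ≤ 2 * m → Exhausts (eT (suc j)) (b ∷ c) (d + ε) (b' ∷ c')
  tensor-e inv eb εb≤ done d≡ ec fc bd = tensor-e-right inv eb εb≤ (m∸n≡0⇒m≤n (sym d≡)) ec fc bd
  tensor-e inv (done eq) εb≤ (step eq' pw) d≡ ec fc bd with () ← trans (sym eq) eq'
  tensor-e {ε = ε} {φ = φ} {c = c} inv eb@(step {k = εb} eq s) εb≤ (step eq' pw) d≡ ec fc bd
    with refl ← just-injective (trans (sym eq) eq') =
    step (trans (e-left eb εb≤ fc (m≤n⇒m≤1+n (≤-trans (m≤n+m φ ε) bd)) φ<) (cong (Maybe.map (_∷ c)) eq))
      (tensor-e inv s (<⇒≤ εb≤) pw (suc-injective (trans d≡ (+-∸-assoc 1 (≤-pred φ<)))) ec fc bd)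
    where
    φ< : φ < suc εb
    φ< = ≰⇒> λ le → contradiction (trans d≡ (m≤n⇒m∸n≡0 le)) λ ()

  -- Each step of f on b raises ε(b), since e undoes f; so once φ(c) ≤ ε(b), the tensor rule keeps
  -- choosing b.
  tensor-f-left : ∀ {m b εb b₁ φb b₂ φ} {c c″ : SVW n m} → Exhausts e b εb b₁ → Exhausts f b φb b₂ → εb + φb ≤ 2 → φ ≤ εb →
    Exhausts (fT (suc j)) c φ c″ → φ ≤ 2 * m → Exhausts (fT (suc j)) (b ∷ c) φb (b₂ ∷ c)
  tensor-f-left {εb = εb} {c = c} eb (done eq) le φ≤ fc bd =
    done (trans (f-left eb (m≤n⇒m≤1+n (≤-trans (m≤m+n εb 0) le)) fc (m≤n⇒m≤1+n bd) φ≤) (cong (Maybe.map (_∷ c)) eq))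
  tensor-f-left {εb = εb} {c = c} eb (step {k = k} eq s) le φ≤ fc bd =
    step (trans (f-left eb (m≤n⇒m≤1+n (≤-trans (m≤m+n εb (suc k)) le)) fc (m≤n⇒m≤1+n bd) φ≤) (cong (Maybe.map (_∷ c)) eq))
      (tensor-f-left (step (f⇒e eq) eb) s (subst (_≤ 2) (+-suc εb k) le) (m≤n⇒m≤1+n φ≤) fc bd)

  tensor-f : ∀ {m b εb b₁ φb b₂ φ} {c c″ : SVW n m} → Exhausts e b εb b₁ → Exhausts f b φb b₂ → εb + φb ≤ 2 →
    Exhausts (fT (suc j)) c φ c″ → φ ≤ 2 * m → ∃[ z ] Exhausts (fT (suc j)) (b ∷ c) ((φ ∸ εb) + φb) z
  tensor-f {εb = εb} {φ = φ} eb fb le fc bd with φ ≤? εb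
  ... | yes φ≤ rewrite m≤n⇒m∸n≡0 φ≤ = _ , tensor-f-left eb fb le φ≤ fc bd
  tensor-f eb fb le (done eq) bd | no φ≰ = contradiction z≤n φ≰
  tensor-f {b = b} {εb = εb} {φ = suc φ} eb fb le fc@(step eq s) bd | no φ≰
    rewrite +-∸-assoc 1 (≤-pred (≰⇒> φ≰)) with z , s' ← tensor-f eb fb le s (<⇒≤ bd) =
    z , step (trans (f-right eb (m≤n⇒m≤1+n (≤-trans (m≤m+n εb _) le)) fc (m≤n⇒m≤1+n bd) (≰⇒> φ≰)) (cong (Maybe.map (b ∷_)) eq)) s'

  -- E (b ⊗ c) = e^(ε(b) ∸ φ(c)) b ⊗ E c, since every step on c raises φ(c).
  tensor-strings : ∀ {m b b' p q ε φ} {c c' : SVW n m} → Inverse m → Strings c ε φ c' → Bits b p q →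
    Iterates e (εbits p q ∸ φ) b b' →
    Strings (b ∷ c) ((εbits p q ∸ φ) + ε) ((φ ∸ εbits p q) + φbits p q) (b' ∷ c')
  tensor-strings {m} {p = p} {q} {ε} {φ} inv (strings ec fc bd) B pw
    with _ , eb ← e-str B | _ , fb ← f-str B
    with _ , fs ← tensor-f eb fb (εbits+φbits p q) fc (≤-trans (m≤n+m φ ε) bd) =
    strings (tensor-e inv eb (m≤n⇒m≤1+n (≤-trans (m≤m+n _ _) (εbits+φbits p q))) pw refl ec fc bd) fs
      (≤-trans (+-mono-≤ (+-monoˡ-≤ ε (m∸n≤m (εbits p q) φ)) (+-monoˡ-≤ (φbits p q) (m∸n≤m φ (εbits p q))))
        (≤-trans (≤-reflexive (lem (εbits p q) ε φ (φbits p q)))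
          (≤-trans (+-mono-≤ (εbits+φbits p q) bd) (≤-reflexive (sym (*-suc 2 m))))))
    where
    lem : ∀ a b c d → a + b + (c + d) ≡ (a + d) + (b + c)
    lem = solve-∀

  map-just : ∀ {A B : Set} {g : A → B} x {y} → Maybe.map g x ≡ just y → ∃[ z ] x ≡ just z × g z ≡ y
  map-just (just z) refl = z , refl , refl

  -- A step of e on c raises φ(c) by one and a step on b lowers ε(b) by one. This turns ≤ into < and
  -- > into ≥, so f selects the factor on which e has acted.
  inverse-suc : ∀ {m} → Inverse m → (∀ (c : SVW n m) → ∃[ ε ] ∃[ φ ] ∃[ c' ] Strings c ε φ c') → Inverse (suc m)
  inverse-suc {m} inv all-strings (b ∷ c) x eq
    with _ , φ , _ , strings ec fc bd ← all-strings c | _ , eb ← e-str (bits-of b)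
    with εbits (memV b j) (memV b (suc j)) ≤? φ
       | ≤-trans (m≤m+n _ _) (εbits+φbits (memV b j) (memV b (suc j)))
  ... | yes le | ε≤2
    with c₁ , eq₁ , refl ← map-just (eT (suc j) c) (trans (sym (e-right eb (m≤n⇒m≤1+n ε≤2) fc (m≤n⇒m≤1+n (≤-trans (m≤n+m _ _) bd)) le)) eq) =
    trans (f-right eb (m≤n⇒m≤1+n ε≤2) (step (inv _ _ eq₁) fc) (s≤s (≤-trans (m≤n+m _ _) bd)) (s≤s le))
      (cong (Maybe.map (b ∷_)) (inv _ _ eq₁))
  ... | no gt | ε≤2
    with b₁ , eq₁ , refl ← map-just (e b) (trans (sym (e-left eb (m≤n⇒m≤1+n ε≤2) fc (m≤n⇒m≤1+n (≤-trans (m≤n+m _ _) bd)) (≰⇒> gt))) eq)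
    = go eb eq₁ (≰⇒> gt) ε≤2
    where
    go : ∀ {εb b₁ z} → Exhausts e b εb z → e b ≡ just b₁ → φ < εb → εb ≤ 2 → fT (suc j) (b₁ ∷ c) ≡ just (b ∷ c)
    go (step eq s) eq₁ (s≤s lt) le with refl ← just-injective (trans (sym eq) eq₁) =
      trans (f-left s (m≤n⇒m≤1+n (<⇒≤ le)) fc (m≤n⇒m≤1+n (≤-trans (m≤n+m _ _) bd)) lt)
        (cong (Maybe.map (_∷ c)) (e⇒f eq))

  strings-[] : Strings [] 0 0 []
  strings-[] = strings (done refl) (done refl) z≤n

  inverse-and-strings : ∀ m → Inverse m × (∀ (c : SVW n m) → ∃[ ε ] ∃[ φ ] ∃[ c' ] Strings c ε φ c')
  inverse-and-strings zero = (λ _ _ ()) , λ { [] → _ , _ , _ , strings-[] }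
  inverse-and-strings (suc m) with inv , all-strings ← inverse-and-strings m = inverse-suc inv all-strings , λ { (b ∷ c) → go b (all-strings c) }
    where
    go : ∀ b {c : SVW n m} → (∃[ ε ] ∃[ φ ] ∃[ c' ] Strings c ε φ c') → ∃[ ε ] ∃[ φ ] ∃[ c' ] Strings (b ∷ c) ε φ c'
    go b (_ , φ , _ , d) with _ , pw , _ ← e-pow (εbits (memV b j) (memV b (suc j)) ∸ φ) (m∸n≤m _ φ) (bits-of b) =
      _ , _ , _ , tensor-strings (proj₁ (inverse-and-strings m)) d (bits-of b) pw

  strings-E : ∀ {m ε φ} {c c' : SVW n m} → Strings c ε φ c' → E (suc j) c ≡ just c'
  strings-E {m} {ε} {φ} {c} (strings ec fc bd) =
    trans (cong (λ k → iterM k (eT (suc j)) c) (exhausts-count ec (m≤n⇒m≤1+n (≤-trans (m≤m+n ε φ) bd)))) (exhausts-iterM ec)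

-- Steps of the row data as powers of e

present : Origin → Bool
present none = false
present (some _) = true

φRow : Bool → ℕ → ℕ
φRow f z = bit f + 2 * z

φRow-suc : ∀ f z → φRow f (suc z) ≡ 2 + φRow f z
φRow-suc f z = trans (cong (bit f +_) (*-suc 2 z)) (trans (+-suc (bit f) (suc (2 * z))) (cong suc (+-suc (bit f) (2 * z))))

-- The link between the two sides: z columns free for new boxes, and one more
-- failed insertion if f is true, correspond to φ = 2z + f.
data Block {n} : ∀ {m k} → SVW n m → SVW n m → Rows k → Set where
  top : ∀ {m a z} {c : SVW n m} → Block c c (top a z)
  row : ∀ {m k a f z ε} {R : Rows k} {c c₁ c' : SVW n m} (lt : suc k < n) → Pair.Strings k lt c ε (φRow f z) c₁ →
        Block c₁ c' R → Block c c' (row a f z R)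

block-just : ∀ {n m k} {c c' : SVW n m} {R : Rows k} → Block c c' R → block k c ≡ just c'
block-just top = refl
block-just {k = suc k} {c} (row lt d B) = trans (cong (_>>= block k) (Pair.strings-E k lt d)) (block-just B)

block-[] : ∀ {n k} N → k < n → ∃[ R ] Block {n} {k = k} [] [] R × gaps R ≡ noBoxes N k × gaps′ R ≡ noBoxes N (suc k)
  × free R ≡ N × endings (labels R) ≡ []
block-[] {k = zero} N lt = top 0 N , top , refl , refl , refl , lem N
  where
  lem : ∀ N → endings (replicate N nothing ++ []) ≡ []
  lem zero = refl
  lem (suc N) rewrite lem N = refl
block-[] {k = suc k} N lt with R , B , g , g′ , fr , ds ← block-[] {k = k} N (<⇒≤ lt) =
  row 0 false 0 R , row lt (Pair.strings-[] k lt) B , cong (0 ∷_) g ,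
  cong (0 ∷_) g′ , fr , ds

rowBits-cong : ∀ {n} {X Y : Subset n} k → (∀ l → l < k → memV X l ≡ memV Y l) → rowBits X k ≡ rowBits Y k
rowBits-cong zero same = refl
rowBits-cong (suc k) same = cong₂ _∷_ (same k ≤-refl) (rowBits-cong k λ l lt → same l (m<n⇒m<1+n lt))

StepBlock : ∀ {n m k} → Subset n → SVW n m → SVW n m → Rows k → Vec Bool (suc k) → Set
StepBlock {n} {m} {k} X c c' R' bs' = ∃[ X' ] Block (X ∷ c) (X' ∷ c') R' × rowBits X' (suc k) ≡ bs' ×
  (∀ l → k < l → memV X' l ≡ memV X l)

-- The operators following `E (suc k)` in the block do not touch bit `suc k`. So b' is final, while
-- the new bit k is what the next row up receives as `present o'`.
extend : ∀ {n m k ε a' f' z' b b' o o' bs bs'} {X : Subset n} {R' : Rows k} {c c₁ c' : SVW n m} f z (lt : suc k < n) →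
  Pair.Strings k lt c ε (φRow f z) c₁ →
  after (εbits b (present o) ∸ φRow f z) b (present o) ≡ (present o' , b') →
  φRow f' z' ≡ (φRow f z ∸ εbits b (present o)) + φbits b (present o) →
  rowBits X (suc k) ≡ b ∷ bs → memV X (suc k) ≡ present o →
  (∀ X₁ → rowBits X₁ k ≡ bs → memV X₁ k ≡ present o' → StepBlock X₁ c₁ c' R' bs') →
  StepBlock X c c' (row a' f' z' R') (b' ∷ bs')
extend {m = m} {k = k} {ε = ε} {b = b} {o = o} {X = X} {c = c} {c₁ = c₁} f z lt d act φ≡ refl q≡ rec
  with X₁ , pw , B , same ← Pair.e-pow k lt {T = X} (εbits b (present o) ∸ φRow f z) (m∸n≤m _ (φRow f z)) (Pair.bits refl q≡)
  with B | act
... | Pair.bits p₁ q₁ | eq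
  with X' , bl , rb , same' ← rec X₁ (rowBits-cong k λ l l<k → same l (<⇒≢ l<k) (<⇒≢ (m<n⇒m<1+n l<k))) (trans p₁ (cong proj₁ eq)) =
  X' ,
  row lt (subst (λ φ → Pair.Strings k lt (X ∷ c) (εbits b (present o) ∸ φRow f z + ε) φ (X₁ ∷ c₁)) (sym φ≡) (Pair.tensor-strings k lt (proj₁ (Pair.inverse-and-strings k lt m)) d (Pair.bits refl q≡) pw)) bl ,
  cong₂ _∷_ (trans (same' (suc k) ≤-refl) (trans q₁ (cong proj₂ eq))) rb ,
  λ l lt' → trans (same' l (<⇒≤ lt')) (same l (>⇒≢ (<⇒≤ lt')) (>⇒≢ lt'))

step-block : ∀ {n m k o bs bs'} {X : Subset n} {R R' : Rows k} {c c' : SVW n m} → Step o R bs R' bs' →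
  Block c c' R → rowBits X k ≡ bs → memV X k ≡ present o → StepBlock X c c' R' bs'
step-block {X = X} top-none top rb q = X , top , cong (_∷ []) q , λ _ _ → refl
step-block {X = X} top-some top rb q = X , top , cong (_∷ []) q , λ _ _ → refl
step-block (absent {f = f} {z} {b} st) (row lt d B) rb q =
  extend {o = none} f z lt d (act b) (φ b f z) rb q λ X₁ rb₁ q₁ → step-block st B rb₁ q₁
  where
  act : ∀ b → after (εbits b false ∸ φRow f z) b false ≡ (present (next b none) , false)
  act false rewrite 0∸n≡0 (φRow f z) = refl
  act true rewrite 0∸n≡0 (φRow f z) = refl
  φ : ∀ b f z → φRow f (z + bit b) ≡ φRow f z ∸ εbits b false + φbits b false
  φ false f z = trans (cong (φRow f) (+-identityʳ z)) (sym (+-identityʳ (φRow f z)))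
  φ true f z = trans (cong (φRow f) (+-comm z 1)) (trans (φRow-suc f z) (+-comm 2 (φRow f z)))
step-block (room {p = p} {f = f} {z} {b} st) (row lt d B) rb q =
  extend {o = some p} f (suc z) lt d (act b f z) (φ b f z) rb q λ X₁ rb₁ q₁ → step-block st B rb₁ q₁
  where
  act : ∀ b f z → after (εbits b true ∸ φRow f (suc z)) b true ≡ (present (next b none) , true)
  act false f z rewrite φRow-suc f z | 0∸n≡0 (φRow f z) = refl
  act true f z rewrite φRow-suc f z = refl
  φ : ∀ b f z → φRow f (z + bit b) ≡ φRow f (suc z) ∸ εbits b true + φbits b true
  φ false f z rewrite φRow-suc f z = trans (cong (φRow f) (+-identityʳ z)) (sym (+-identityʳ (φRow f z)))
  φ true f z rewrite φRow-suc f z = trans (cong (φRow f) (+-comm z 1)) (trans (φRow-suc f z) (cong suc (+-comm 1 (φRow f z))))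
step-block (full-miss {p = p} {b = b} st) (row lt d B) rb q =
  extend {o = some p} true 0 lt d (act b) (φ b) rb q λ X₁ rb₁ q₁ → step-block st B rb₁ q₁
  where
  act : ∀ b → after (εbits b true ∸ 1) b true ≡ (present (next b (some true)) , true)
  act false = refl
  act true = refl
  φ : ∀ b → φRow b 0 ≡ 1 ∸ εbits b true + φbits b true
  φ false = refl
  φ true = refl
step-block (full-push {b = b} st) (row lt d B) rb q =
  extend {o = some true} false 0 lt d (act b) (φ b) rb q λ X₁ rb₁ q₁ → step-block st B rb₁ q₁
  where
  act : ∀ b → after (εbits b true ∸ 0) b true ≡ (present (next b (some true)) , false)
  act false = refl
  act true = refl
  φ : ∀ b → φRow b 0 ≡ 0 ∸ εbits b true + φbits b true
  φ false = refl
  φ true = refl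
step-block (full-own {b = b} st) (row lt d B) rb q =
  extend {o = some false} false 0 lt d (act b) (φ b) rb q λ X₁ rb₁ q₁ → step-block st B rb₁ q₁
  where
  act : ∀ b → after (εbits b true ∸ 0) b true ≡ (present (next b (some true)) , false)
  act false = refl
  act true = refl
  φ : ∀ b → φRow b 0 ≡ 0 ∸ εbits b true + φbits b true
  φ false = refl
  φ true = refl

-- Rectification

concatMap-zip : ∀ {X : Set} {F G : ℕ × X → List ℕ} {h h' : ℕ → ℕ} m (xs : List X) →
  (∀ j x → F (h j , x) ≡ G (h' j , x)) →
  concatMap F (zip (applyUpTo h m) xs) ≡ concatMap G (zip (applyUpTo h' m) xs)
concatMap-zip zero xs eq = refl
concatMap-zip (suc m) [] eq = refl
concatMap-zip (suc m) (x ∷ xs) eq = cong₂ _++_ (eq 0 x) (concatMap-zip m xs λ j → eq (suc j))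

letter : ℕ → Bool → List ℕ
letter v b = if b then [ v ] else []

Aword-∷ : ∀ {n m} (b : Subset n) (c : SVW n m) i → Aword (b ∷ c) i ≡ letter (suc m) (mem b i) ++ Aword c i
Aword-∷ {m = m} b c i = cong (letter (suc m) (mem b i) ++_) (concatMap-zip m (toList c) λ _ _ → refl)

Aword-< : ∀ {n m} (S : SVW n m) i → All (_< suc m) (Aword S i)
Aword-< [] i = []
Aword-< (b ∷ c) i rewrite Aword-∷ b c i with mem b i
... | false = All.map m<n⇒m<1+n (Aword-< c i)
... | true = ≤-refl ∷ All.map m<n⇒m<1+n (Aword-< c i)

record Inserted {n k m} (N : ℕ) (gs : Vec ℕ (suc k)) (S : SVW n m) (T : Cols) : Set where
  constructor inserted
  field
    {S'} : SVW n m
    {R} : Rows k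
    {T'} : Cols
    block-S : Block S S' R
    gaps≡ : gaps R ≡ gs
    rep-S' : Rep (suc k) N (gaps′ R) S' T'
    run : Run T (Aword S (suc k)) T' (endings (labels R))
    enough : N ≤ free R + m
    other : ∀ i → suc k < i → Aword S' i ≡ Aword S i

run-step : ∀ {n k m N gs T w T' o bs bs' D} {S : SVW n m} {R R' : Rows k} → Rep k N gs S T → gaps R ≡ gs →
  isOwn o ≡ false → Step o R bs R' bs' → D ≡ labels R → All (_< suc m) w → Run T w T' (endings D) →
  Run (addLetter (suc m) (corners gs (false ∷ bs)) T) (letter (suc m) (present o) ++ w)
    (addLetter (suc m) (corners′ R bs') T') (endings (labels R'))
run-step {o = none} {R = R} rep refl o≡ st refl ws run = lift-word {D = labels R} (rep-Below rep) ws run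
  (subst (λ ls → Scan nothing ls _ (labels R) _ _) (sym (rep-heights rep)) (step-scan st))
run-step {o = some true} {R = R} rep refl o≡ st refl ws run with moving h≡ _ _ c≡ sc ← step-scan st =
  push {D = labels R} (rep-Below rep) (trans (rep-heights rep) h≡) c≡ ws run (sc _ λ _ → refl)
  where
  push : ∀ {v w T T' l ls u V W D D'} → All (Below v) T → map length T ≡ l ∷ ls → W ≡ u ∷ V → All (_< v) w →
    Run T w T' (endings D) → ∀ {V'} → Scan (just (not u)) (l ∷ ls) (true ∷ V) D V' D' →
    Run (addLetter v W T) (v ∷ w) (addLetter v V' T') (endings D')
  push {T = _ ∷ _} {D = D} cvs refl refl ws run sc = lift-word∷ {D = D} cvs ws run sc

-- A letter of the row being inserted enters through the first column, exactly like a letter pushed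
-- up from a row below.
origin : Bool → Origin
origin t = if t then some true else none

isOwn-origin : ∀ t → isOwn (origin t) ≡ false
isOwn-origin false = refl
isOwn-origin true = refl

present-origin : ∀ t → present (origin t) ≡ t
present-origin false = refl
present-origin true = refl

insert-row : ∀ {n k N m gs T} {S : SVW n m} → k < n → m ≤ N → Rep k N gs S T → Inserted N gs S T
insert-row {n} {k} {N} k<n m≤N [] with R , B , g , g′ , fr , ds ← block-[] {n} {k} N k<n =
  inserted B g (subst (λ gs → Rep {n} (suc k) N gs [] (replicate N [])) (sym g′) []) (subst (Run _ [] _) (sym ds) [])
    (≤-reflexive (trans (sym fr) (sym (+-identityʳ _)))) λ _ _ → refl
insert-row {n} {k} {N} k<n m<N (_∷_ {m} {gs' = gs'} {b = b} {T} {c} r u)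
  with inserted {c'} {R} {T'} B refl r' run en other ← insert-row k<n (<⇒≤ m<N) r
  with R' , bs' , st , le ← step-exists (origin (memV b k)) R (rowBits b k)
         (+-cancelʳ-≤ m 1 (free R) (≤-trans m<N en))
         (subst (λ o → Upd (gaps R) (o ∷ rowBits b k) gs') (sym (isOwn-origin (memV b k))) u)
  with X' , B' , refl , same ← step-block st B refl (sym (present-origin (memV b k))) =
  inserted B'
    -- The step and the tableau add boxes to the same shape in the same rows, which determines the
    -- new shape.
    (Upd-unique (step-gaps st) (subst (λ o → Upd (gaps R) (o ∷ rowBits b k) gs') (sym (isOwn-origin (memV b k))) u))
    (r' ∷ step-gaps′ (isOwn-origin (memV b k)) st)
    (subst₂ (λ w V → Run (addLetter (suc m) (corners (gaps R) (false ∷ rowBits b k)) T) w (addLetter (suc m) V T') (endings (labels R')))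
      (sym (trans (Aword-∷ b c (suc k)) (cong (λ t → letter (suc m) t ++ Aword c (suc k)) (sym (present-origin (memV b k))))))
      (sym (corners-gaps′ st))
      (run-step r refl (isOwn-origin (memV b k)) st refl (Aword-< c (suc k)) run))
    (≤-trans en (≤-trans (+-monoˡ-≤ m le) (≤-reflexive (sym (+-suc (free R') m)))))
    other'
  where
  other' : ∀ i → suc k < i → Aword (X' ∷ c') i ≡ Aword (b ∷ c) i
  other' (suc l) (s≤s lt) = trans (Aword-∷ X' c' (suc l))
    (trans (cong₂ _++_ (cong (letter (suc m)) (same l lt)) (other (suc l) (s≤s lt))) (sym (Aword-∷ b c (suc l))))

-- Reading off the rows

lookupL-short : ∀ c {r} → length c ≤ r → lookupL c r ≡ nothing
lookupL-short [] _ = refl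
lookupL-short (_ ∷ c) (s≤s le) = lookupL-short c le

lookupL-snoc : ∀ c v → lookupL (c ++ [ v ]) (length c) ≡ just v
lookupL-snoc [] v = refl
lookupL-snoc (_ ∷ c) v = lookupL-snoc c v

lookupL-long : ∀ c {r} → r < length c → ∃[ x ] lookupL c r ≡ just x
lookupL-long (x ∷ c) {zero} lt = x , refl
lookupL-long (_ ∷ c) {suc r} (s≤s lt) = lookupL-long c lt

lookupL-++ : ∀ c {d r x} → lookupL c r ≡ just x → lookupL (c ++ d) r ≡ just x
lookupL-++ (_ ∷ c) {r = zero} eq = eq
lookupL-++ (_ ∷ c) {r = suc r} eq = lookupL-++ c eq

rowAt-short : ∀ {r} T → All (_≤ r) (map length T) → rowAt r T ≡ []
rowAt-short [] _ = refl
rowAt-short (c ∷ T) (le ∷ _) rewrite lookupL-short c le = refl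

heights-< : ∀ {k} (gs : Vec ℕ k) → All (_< k) (heights gs)
heights-< [] = []
heights-< (g ∷ gs) = ++⁺ (replicate⁺ g ≤-refl) (All.map m<n⇒m<1+n (heights-< gs))

data At : ∀ {k} → Vec Bool k → ℕ → Bool → Set where
  here : ∀ {k b} {bs : Vec Bool k} → At (b ∷ bs) k b
  there : ∀ {k r b c} {bs : Vec Bool k} → At bs r b → At (c ∷ bs) r b

At-< : ∀ {k r b} {bs : Vec Bool k} → At bs r b → r < k
At-< here = ≤-refl
At-< (there at) = m<n⇒m<1+n (At-< at)

rowBits-At : ∀ {n} (b : Subset n) k {r} → r < k → At (rowBits b k) r (memV b r)
rowBits-At b (suc k) {r} lt with r ≟ k
... | yes refl = here
... | no r≢k = there (rowBits-At b k (≤∧≢⇒< (≤-pred lt) r≢k))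

rowAt-long : ∀ {r k v X hs V} g W T → r < k → length W ≡ g → map length T ≡ replicate g k ++ hs →
  (∀ T₂ → map length T₂ ≡ hs → rowAt r (addLetter v V T₂) ≡ rowAt r T₂ ++ X) →
  rowAt r (addLetter v (W ++ V) T) ≡ rowAt r T ++ X
rowAt-long zero [] T lt _ h rec = rec T h
rowAt-long {r} {v = v} (suc g) (w ∷ W) (c ∷ T) lt wl h rec
  with x , eq ← lookupL-long c (subst (r <_) (sym (∷-injectiveˡ h)) lt) with w
... | false rewrite eq = cong (x ∷_) (rowAt-long g W T lt (suc-injective wl) (∷-injectiveʳ h) rec)
... | true rewrite eq | lookupL-++ c {[ v ]} eq = cong (x ∷_) (rowAt-long g W T lt (suc-injective wl) (∷-injectiveʳ h) rec)

length-first : ∀ b g → length (first b g) ≡ g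
length-first b zero = refl
length-first b (suc g) = cong suc (length-replicate g)

-- Columns before the group of length r are longer than r and keep their entry in row r. After the
-- group's first column, all columns have length at most r, even with v appended, so row r ends with
-- v.
rowAt-addLetter : ∀ {k r b v} {gs gs' : Vec ℕ k} {bs} T → At bs r b → Upd gs bs gs' → map length T ≡ heights gs →
  rowAt r (addLetter v (corners gs bs) T) ≡ rowAt r T ++ letter v b
rowAt-addLetter T (there {c = c} at) (cons {g = g} _ _ u) h =
  rowAt-long g (first c g) T (At-< at) (length-first c g) h λ T₂ h₂ → rowAt-addLetter T₂ at u h₂
rowAt-addLetter {r = r} {v = v} {gs' = gs'} T (here {b = false} {bs}) u@(cons {g = g} {gs = gs} refl refl _) h =
  trans (rowAt-short (addLetter v (corners (g ∷ gs) (false ∷ bs)) T)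
      (subst (All (_≤ r)) (sym (addLetter-heights v T u h)) (All.map ≤-pred (heights-< gs'))))
    (sym (trans (++-identityʳ _) (rowAt-short T (subst (All (_≤ r)) (sym h) (All.map ≤-pred (heights-< (g ∷ gs)))))))
rowAt-addLetter {r = r} {v = v} {gs' = gs'} (c ∷ T) (here {b = true} {bs}) u@(cons {h = h} {gs = gs} refl refl _) eq
  with refl ← ∷-injectiveˡ eq
  rewrite lookupL-snoc c v | lookupL-short c {length c} ≤-refl =
  cong (v ∷_) (rowAt-short (addLetter v (replicate h false ++ corners gs bs) T)
    (subst (All (_≤ length c)) (sym (∷-injectiveʳ (addLetter-heights v (c ∷ T) u eq))) (All.map ≤-pred (heights-< gs'))))

reverse-letter : ∀ v b w → reverse (letter v b ++ w) ≡ reverse w ++ letter v b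
reverse-letter v false w = sym (++-identityʳ _)
reverse-letter v true w = unfold-reverse v w

rep-rowAt : ∀ {n k N m gs T r} {S : SVW n m} → Rep k N gs S T → r < k → rowAt r T ≡ reverse (Aword S (suc r))
rep-rowAt {N = N} {r = r} [] lt = rowAt-short (replicate N []) (subst (All _) (sym (map-length-replicate N)) (replicate⁺ N z≤n))
rep-rowAt {k = k} {r = r} (_∷_ {m} {b = b} {T} {c} rep u) lt = trans (rowAt-addLetter T (there (rowBits-At b k lt)) u (rep-heights rep))
  (trans (cong (_++ _) (rep-rowAt rep lt))
    (sym (trans (cong reverse (Aword-∷ b c (suc r))) (reverse-letter (suc m) (memV b r) (Aword c (suc r))))))

dropEmpty-++ : ∀ {xs ys} → All (λ x → null x ≡ true) xs → dropEmpty (xs ++ ys) ≡ dropEmpty ys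
dropEmpty-++ [] = refl
dropEmpty-++ (p ∷ ps) rewrite p = dropEmpty-++ ps

dropEmpty-id : ∀ {xs} → All (λ x → null x ≡ false) xs → dropEmpty xs ≡ xs
dropEmpty-id [] = refl
dropEmpty-id (p ∷ ps) rewrite p = refl

reverse⁺ : ∀ {X : Set} {P : X → Set} {xs} → All P xs → All P (reverse xs)
reverse⁺ [] = []
reverse⁺ {P = P} {x ∷ xs} (p ∷ ps) = subst (All P) (sym (unfold-reverse x xs)) (∷ʳ⁺ (reverse⁺ ps) p)

strip-++ : ∀ {xs ys} → All (λ x → null x ≡ false) xs → All (λ x → null x ≡ true) ys → stripTrailingEmpty (xs ++ ys) ≡ xs
strip-++ {xs} {ys} ps qs rewrite reverse-++ xs ys | dropEmpty-++ {ys = reverse xs} (reverse⁺ qs) | dropEmpty-id (reverse⁺ ps) =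
  reverse-involutive xs

applyUpTo-cong : ∀ {X : Set} {f g : ℕ → X} n → (∀ {i} → i < n → f i ≡ g i) → applyUpTo f n ≡ applyUpTo g n
applyUpTo-cong zero eq = refl
applyUpTo-cong (suc n) eq = cong₂ _∷_ (eq (s≤s z≤n)) (applyUpTo-cong n (eq ∘ s≤s))

applyUpTo-+ : ∀ {X : Set} (f : ℕ → X) h d → applyUpTo f (h + d) ≡ applyUpTo f h ++ applyUpTo (f ∘ (h +_)) d
applyUpTo-+ f zero d = refl
applyUpTo-+ f (suc h) d = cong (f 0 ∷_) (applyUpTo-+ (f ∘ suc) h d)

rowAt-pad : ∀ r cols p → rowAt r (cols ++ replicate p []) ≡ rowAt r cols
rowAt-pad r [] zero = refl
rowAt-pad r [] (suc p) = refl
rowAt-pad r (c ∷ cols) p with lookupL c r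
... | nothing = refl
... | just v = cong (v ∷_) (rowAt-pad r cols p)

tab≡rows : ∀ {n N m gs T} {S : SVW n m} → Rep n N gs S T → ∀ {cols} → Padded T cols →
  tab S ≡ stripTrailingEmpty (applyUpTo (λ r → rowAt r cols) n)
tab≡rows {n} rep {cols} (p , refl) = cong stripTrailingEmpty (trans (map-upTo _ n)
  (applyUpTo-cong n λ {r} lt → trans (sym (rep-rowAt rep lt)) (rowAt-pad r cols p)))

rowAt-nonempty : ∀ {r c} cs → r < length c → null (rowAt r (c ∷ cs)) ≡ false
rowAt-nonempty {c = c} cs lt with x , eq ← lookupL-long c lt rewrite eq = refl

rowAt-empty : ∀ {r} c {cs} → length c ≤ r → null (rowAt r (c ∷ cs)) ≡ true
rowAt-empty c le rewrite lookupL-short c le = refl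

-- The first column is the longest: the rows it meets are nonempty, and the remaining ones up to n
-- are empty and get stripped.
tab≡colsToRows : ∀ {n N m gs T} {S : SVW n m} → Rep n N gs S T → ∀ cols → Padded T cols → tab S ≡ colsToRows cols
tab≡colsToRows {n} rep [] pd = trans (tab≡rows rep pd) (strip-++ [] (applyUpTo⁺₂ (λ _ → []) n λ _ → refl))
tab≡colsToRows {n} {gs = gs} rep (c ∷ cs) pd@(_ , refl) = trans (tab≡rows rep pd)
  (trans (cong stripTrailingEmpty (trans (cong (applyUpTo rowOf) (sym (m+[n∸m]≡n h≤n))) (applyUpTo-+ rowOf (length c) (n ∸ length c))))
    (trans (strip-++ (applyUpTo⁺₁ rowOf (length c) (rowAt-nonempty {c = c} cs)) (applyUpTo⁺₂ _ (n ∸ length c) λ i → rowAt-empty c (m≤m+n (length c) i)))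
      (sym (map-upTo rowOf (length c)))))
  where
  rowOf : ℕ → List ℕ
  rowOf r = rowAt r (c ∷ cs)
  h≤n : length c ≤ n
  h≤n = ≤-pred (All.head (subst (All _) (sym (rep-heights rep)) (heights-< gs)))

addLetter-none : ∀ v T N → addLetter v (first false N ++ []) T ≡ T
addLetter-none v T N rewrite first-false N = go N T
  where
  go : ∀ N T → addLetter v (replicate N false ++ []) T ≡ T
  go zero [] = refl
  go zero (_ ∷ _) = refl
  go (suc N) [] = refl
  go (suc N) (c ∷ T) = cong (c ∷_) (go N T)

rep-empty : ∀ {n m} N (S : SVW n m) → Rep 0 N (N ∷ []) S (replicate N [])
rep-empty N [] = []
rep-empty {m = suc m} N (b ∷ c) = subst (Rep 0 N (N ∷ []) (b ∷ c)) (addLetter-none (suc m) (replicate N []) N)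
  (rep-empty N c ∷ cons refl (sym (+-identityʳ N)) [])

record Rectified {n m} (k : ℕ) (S : SVW n m) : Set where
  constructor rectified
  field
    {S'} : SVW n m
    {gs} : Vec ℕ (suc k)
    {T} : Cols
    rect≡ : rectUpTo (k ∸ 1) S ≡ just S'
    rep : Rep k m gs S' T
    padded : Padded T (foldl heckeInsertCols [] (concatMap (Aword S ∘ suc) (upTo k)))
    good : Good [] (foldl heckeInsertCols [] (concatMap (Aword S ∘ suc) (upTo k)))
    other : ∀ i → k < i → Aword S' i ≡ Aword S i

-- One row needs no operators, so rows run one ahead of blocks. For k = 0 the truncated `k ∸ 1` is
-- harmless since `block 0` does nothing.
rect-suc : ∀ {n m} k {S S₁ S' : SVW n m} → rectUpTo (k ∸ 1) S ≡ just S₁ → block k S₁ ≡ just S' → rectUpTo k S ≡ just S'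
rect-suc zero eq₁ eq₂ = trans eq₁ eq₂
rect-suc (suc k) eq₁ eq₂ rewrite eq₁ = eq₂

rectify : ∀ {n m} k (S : SVW n m) → k ≤ n → Rectified k S
rectify {m = m} zero S _ = rectified refl (rep-empty m S) (m , refl) [] λ _ _ → refl
rectify (suc k) S k<n
  with rectified {S₁} {T = T} r≡ rep pd g other ← rectify k S (<⇒≤ k<n)
  with inserted {T' = T'} B refl rep' run _ other' ← insert-row k<n ≤-refl rep
  with pd' , g' ← run-foldl run pd g =
  rectified (rect-suc k r≡ (block-just B)) rep'
    (subst (λ cs → Padded T' cs) eq pd') (subst (Good []) eq g')
    λ i lt → trans (other' i lt) (other i (<⇒≤ lt))
  where
  W = Aword S ∘ suc
  eq : foldl heckeInsertCols (foldl heckeInsertCols [] (concatMap W (upTo k))) (Aword S₁ (suc k)) ≡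
       foldl heckeInsertCols [] (concatMap W (upTo (suc k)))
  -- Rectifying the first k rows leaves row `suc k` alone, so its word is still that of S.
  eq = trans (cong (foldl heckeInsertCols _) (trans (other (suc k) ≤-refl) (sym (++-identityʳ _))))
    (trans (sym (foldl-++ heckeInsertCols [] (concatMap W (upTo k)) (concatMap W [ k ])))
      (cong (foldl heckeInsertCols []) (trans (sym (concatMap-++ W (upTo k) [ k ])) (cong (concatMap W) (upTo-∷ʳ k)))))

theorem3p11 : (n m : ℕ) (S : SVW n m) →
    Maybe.map tab (rect S) ≡ just (Phecke S)
theorem3p11 n m S with rectified r≡ rep pd g _ ← rectify n S ≤-refl =
  trans (cong (Maybe.map tab) r≡) (cong just (tab≡colsToRows rep _ pd))
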